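{- Let $p$ be a prime and let $q$ be an odd power of $p$ (that is, $q=p^{2r+1}$ for some integer $r\ge 0$). Let $S \subseteq \mathbb{F}_q^*$ with $S=-S$ be such that $S/S \neq \mathbb{F}_q^*$. Then $$\omega(\operatorname{Cay}(\mathbb{F}_q^+;S))< \sqrt{|S/S|}+1 \quad\text{if } q=p,$$ and $$\omega(\operatorname{Cay}(\mathbb{F}_q^+;S))< \sqrt{|S/S|}+\sqrt{q/p}-1 \quad\text{if } q\neq p.$$
   Context: $\mathbb{F}_q$ is the finite field with $q$ elements, $\mathbb{F}_q^+$ its additive group, and $\mathbb{F}_q^*=\mathbb{F}_q\setminus\{0\}$. For $S\subseteq \mathbb{F}_q^*$, $-S=\{ -s: s\in S\}$ and $S/S=\{a/b: a,b\in S\}$. For $S=-S$, the Cayley graph $\operatorname{Cay}(\mathbb{F}_q^+;S)$ is the (undirected) graph with vertex set $\mathbb{F}_q$ in which two vertices are adjacent if and only if their difference lies in $S$. The clique number $\omega(X)$ of a graph $X$ is the maximum number of vertices of a complete subgraph of $X$.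
   Formalization: Two cases where the printed inequality fails are excluded: S empty when q = p (it would read 1 < 1), and |S| ≤ 1 when q = 8 (it would read 2 < 2 for a singleton S and 1 < 1 for empty S). -}

module Defs where

open import Algebra.Bundles using (CommutativeRing)
open import Data.Fin using (Fin)
open import Data.Fin.Properties using (any?) renaming (_≟_ to _≟ꟳ_)
open import Data.Integer as ℤ using (ℤ; +_; 0ℤ)
open import Data.List using (List; length; filter; tabulate)
open import Data.Nat as ℕ using (ℕ)
open import Data.Product using (∃; _×_; _,_; proj₁; proj₂)
open import Data.Sum using (_⊎_)
open import Function.Bundles using (Inverse)
open import Level using (Level; _⊔_; suc)
open import Relation.Binary using (Setoid; Rel; Symmetric; _Respects₂_; _Respects_)
import Relation.Binary as B
open import Relation.Binary.PropositionalEquality as ≡ using (_≡_; _≢_)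
open import Relation.Nullary using (¬_; Dec; map′)
open import Relation.Nullary.Decidable using (_×-dec_; ¬?)
open import Relation.Unary using (Pred; Decidable; _⊆_; _≐_)

-- The value 0# ⁻¹ is arbitrary.
record FiniteField c ℓ (q : ℕ) : Set (suc (c ⊔ ℓ)) where
  field
    commutativeRing : CommutativeRing c ℓ
  open CommutativeRing commutativeRing public
  infix 8 _⁻¹
  field
    0≉1        : ¬ (0# ≈ 1#)
    _⁻¹        : Carrier → Carrier
    ⁻¹-cong    : ∀ {x y} → x ≈ y → x ⁻¹ ≈ y ⁻¹
    ⁻¹-inverse : ∀ x → ¬ (x ≈ 0#) → x * x ⁻¹ ≈ 1#
    enum       : Inverse setoid (≡.setoid (Fin q))

  open Inverse enum public using (to; from; to-cong; from-cong; inverseˡ; inverseʳ)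

  infixl 7 _/_
  _/_ : Carrier → Carrier → Carrier
  x / y = x * y ⁻¹

  from-to : ∀ x → from (to x) ≈ x
  from-to x = inverseʳ ≡.refl

  infix 4 _≈?_
  _≈?_ : B.Decidable _≈_
  x ≈? y = map′ (λ e → trans (sym (from-to x)) (trans (from-cong e) (from-to y)))
                to-cong (to x ≟ꟳ to y)

  elements : List Carrier
  elements = tabulate from

-- The subsets of a classical finite set are the decidable ones.
record Subset {c ℓ q} (F : FiniteField c ℓ q) s : Set (c ⊔ ℓ ⊔ suc s) where
  open FiniteField F
  field
    mem  : Pred Carrier s
    mem? : Decidable mem
    resp : mem Respects _≈_
open Subset

module _ {c ℓ q} {F : FiniteField c ℓ q} where
  open FiniteField F

  ∃? : ∀ {s} (P : Subset F s) → Dec (∃ (mem P))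
  ∃? P = map′ (λ (i , m) → from i , m)
              (λ (x , m) → to x , resp P (sym (from-to x)) m)
              (any? (λ i → mem? P (from i)))

  -- `elements` lists every element exactly once, so filtering it counts.
  ∣_∣ : ∀ {s} → Subset F s → ℕ
  ∣ P ∣ = length (filter (mem? P) elements)

  infix 4 _⊆ˢ_ _≐ˢ_
  _⊆ˢ_ : ∀ {s t} → Subset F s → Subset F t → Set (c ⊔ s ⊔ t)
  P ⊆ˢ Q = mem P ⊆ mem Q

  _≐ˢ_ : ∀ {s t} → Subset F s → Subset F t → Set (c ⊔ s ⊔ t)
  P ≐ˢ Q = mem P ≐ mem Q

  F* : Subset F ℓ
  F* = record
    { mem  = λ x → ¬ (x ≈ 0#)
    ; mem? = λ x → ¬? (x ≈? 0#)
    ; resp = λ x≈y x≉0 y≈0 → x≉0 (trans x≈y y≈0)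
    }

  neg : ∀ {s} → Subset F s → Subset F (c ⊔ ℓ ⊔ s)
  neg S = record
    { mem  = λ x → ∃ λ s → mem S s × x ≈ - s
    ; mem? = λ x → ∃? (record
        { mem  = λ s → mem S s × x ≈ - s
        ; mem? = λ s → mem? S s ×-dec (x ≈? - s)
        ; resp = λ s≈t (m , e) → resp S s≈t m , trans e (-‿cong s≈t)
        })
    ; resp = λ x≈y (s , m , e) → s , m , trans (sym x≈y) e
    }

  quotients : ∀ {s} → Subset F s → Subset F (c ⊔ ℓ ⊔ s)
  quotients S = record
    { mem  = λ x → ∃ λ a → ∃ λ b → mem S a × mem S b × x ≈ a / b
    ; mem? = λ x → ∃? (record
        { mem  = λ a → ∃ λ b → mem S a × mem S b × x ≈ a / b
        ; mem? = λ a → ∃? (record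
            { mem  = λ b → mem S a × mem S b × x ≈ a / b
            ; mem? = λ b → mem? S a ×-dec (mem? S b ×-dec (x ≈? a / b))
            ; resp = λ b≈b′ (ma , mb , e) →
                ma , resp S b≈b′ mb , trans e (*-congˡ (⁻¹-cong b≈b′))
            })
        ; resp = λ a≈a′ (b , ma , mb , e) →
            b , resp S a≈a′ ma , mb , trans e (*-congʳ a≈a′)
        })
    ; resp = λ x≈y (a , b , ma , mb , e) → a , b , ma , mb , trans (sym x≈y) e
    }

record Graph {v ℓ} (V : Setoid v ℓ) a : Set (v ⊔ ℓ ⊔ suc a) where
  open Setoid V
  field
    Adj         : Rel Carrier a
    Adj-resp    : Adj Respects₂ _≈_
    Adj-sym     : Symmetric Adj
    Adj-irrefl  : ∀ {x y} → x ≈ y → ¬ Adj x y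

module _ {v ℓ a} {V : Setoid v ℓ} (X : Graph V a) where
  open Setoid V using (Carrier)
  open Graph X

  -- The k vertices are distinct because adjacency is irreflexive.
  HasClique : ℕ → Set (v ⊔ a)
  HasClique k = ∃ λ (f : Fin k → Carrier) → ∀ {i j} → i ≢ j → Adj (f i) (f j)

  IsCliqueNumber : ℕ → Set (v ⊔ a)
  IsCliqueNumber ω = HasClique ω × (∀ k → HasClique k → k ℕ.≤ ω)

module _ {c ℓ q} {F : FiniteField c ℓ q} where
  open FiniteField F
  open import Algebra.Properties.Ring ring using (-‿involutive; -‿+-comm)

  private
    swap-difference : ∀ x y → - (x - y) ≈ y - x
    swap-difference x y =
      trans (sym (-‿+-comm x (- y)))
            (trans (+-congˡ (-‿involutive y)) (+-comm (- x) y))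

  Cay : ∀ {s} (S : Subset F s) → S ⊆ˢ F* → S ≐ˢ neg S → Graph setoid s
  Cay S S⊆F* S≐-S = record
    { Adj        = λ x y → mem S (x - y)
    ; Adj-resp   = (λ y≈z → resp S (+-congˡ (-‿cong y≈z)))
                 , (λ y≈z → resp S (+-congʳ y≈z))
    ; Adj-sym    = λ {x} {y} m →
        proj₂ S≐-S (x - y , m , sym (swap-difference x y))
    ; Adj-irrefl = λ {x} {y} x≈y m →
        S⊆F* m (trans (+-congʳ x≈y) (-‿inverseʳ y))
    }

-- The real inequality w < √m + k: with x = w - k it says x < √m, that is,
-- x < 0 or x² < m.
infix 4 _<√_+_
_<√_+_ : ℕ → ℕ → ℤ → Set
w <√ m + k = x ℤ.< 0ℤ ⊎ x ℤ.* x ℤ.< + m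
  where x = + w ℤ.- k

-- Let A = {f i} be a clique with N vertices and Y the set of y ≠ 0 outside S/S.  For
-- y ∈ Y the N² elements a − y b (a, b ∈ A) are distinct roots of x^q − x, so their
-- complete homogeneous symmetric functions h_j(y) vanish for q − N² < j < q − 1.  As
-- h_j is a polynomial of degree at most j in y, it vanishes identically for j < |Y|,
-- in particular at y = 0.  Hence ∏ (x − a)ᴺ has a multiple G = x^q + (terms of degree
-- ≤ q − |Y|), where q − |Y| ≤ |S/S| + 1.
--
-- Write q = p^(2r+1).  Either some Hasse derivative of G of order k = p^e ≤ p^r is
-- nonzero, and counting its (N − k)-fold roots a ∈ A gives N (N − k) + k ≤ |S/S| + 1;
-- or G is a polynomial in x^(p^(r+1)), and counting roots gives N ≤ p^r.
module Submission where

open import Defs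
open import Algebra.Bundles using (CommutativeRing)
open import Data.Fin as Fin using (Fin)
open import Data.Fin.Permutation using (Permutation; permutation; _⟨$⟩ʳ_)
import Data.Fin.Properties as Fin
import Data.Integer as ℤ
import Data.Integer.Properties as ℤ
open import Data.List using (List; []; _∷_; foldr; length; map; replicate; concatMap; _++_;
  filter; allFin; cartesianProductWith)
open import Data.List.Properties using (length-replicate; length-++; length-map; length-tabulate;
  map-++; foldr-++; filter-accept)
open import Data.List.Membership.Propositional using (_∈_)
open import Data.List.Membership.Propositional.Properties using (∈-allFin; ∈-filter⁺; ∈-tabulate⁺)
open import Data.List.Relation.Unary.All as All using (All; []; _∷_)
import Data.List.Relation.Unary.All.Properties as All
open import Data.List.Relation.Unary.AllPairs as AllPairs using (AllPairs; []; _∷_)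
import Data.List.Relation.Unary.AllPairs.Properties as AllPairs
open import Data.List.Relation.Unary.Any as Any using (here; there)
import Data.List.Relation.Unary.Any.Properties as Any
import Data.List.Relation.Unary.Unique.Propositional.Properties as Unique using (allFin⁺)
import Data.List.Relation.Unary.Unique.Setoid.Properties as Unique
open import Data.Nat as ℕ using (ℕ; zero; suc; _<_; _≤_; _∸_; z≤n; s≤s; z<s; s<s; NonZero)
import Data.Nat.Properties as ℕ
open import Data.Nat.Combinatorics
  using (_C_; k>n⇒nCk≡0; nCk+nC[k+1]≡[n+1]C[k+1]; nC1≡n)
open import Data.Nat.Coprimality using (Coprime; coprime-Bézout)
open import Data.Nat.Divisibility as ∣ using (_∣_; _∣?_; divides)
open import Data.Nat.GCD using (module Bézout)
open import Data.Nat.Primality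
  using (Prime; euclidsLemma; prime⇒irreducible; prime⇒nonTrivial; prime⇒nonZero)
open import Data.Nat.Tactic.RingSolver using (solve-∀)
open import Data.Product using (∃; _×_; _,_; proj₁; proj₂)
open import Data.Sum using (_⊎_; inj₁; inj₂)
open import Data.Vec.Functional using (removeAt)
open import Function using (_∘_)
open import Level using (Level)
open import Relation.Binary using (tri<; tri≈; tri>)
import Relation.Binary.Construct.On as On
open import Relation.Binary.PropositionalEquality as ≡ using (_≡_; _≢_)
open import Relation.Nullary using (¬_; yes; no; contradiction; decidable-stable)
open import Relation.Nullary.Decidable using (_×-dec_; ¬?)
open import Relation.Unary using (Pred; Decidable)

-- The point y = 0 is not in Y: there the N² values collapse to N copies of each a, and this
-- multiplicity, which no single y in Y provides, is what the derivatives exploit. They have to be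
-- Hasse derivatives, since ordinary ones of order at least p vanish in characteristic p. The order
-- p^e is the exact power of p in some exponent of G that p^(r+1) does not divide: C(m p^e, p^e) ≡ m
-- mod p keeps that term alive while x^q is killed, so the degree falls to at most q - |Y| - k.
--
-- Write T = p^r and s = |S/S|. Since N (N - k) + k does not increase with k, the worst case is k =
-- T, and for x = N - T + 1 the bound becomes x² + (T - 2) x ≤ s. For T ≥ 3 and x ≥ 1 this gives x²
-- < s. For T = 1, that is q = p, it reads N (N - 1) ≤ s, which exceeds the required (N - 1)² < s
-- when N ≥ 2. For T = 2, that is q = 8, strictness is lost, and N² ≤ q takes over. Small x is
-- settled by exhibiting one or two quotients.

-- Binomial coefficients modulo a prime.

module PrimePowerBinomials where
  open import Data.Nat using (_+_; _*_; _^_)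

  [1+k]*[1+n]C[1+k]≡[1+n]*nCk : ∀ n k → suc k * (suc n C suc k) ≡ suc n * (n C k)
  [1+k]*[1+n]C[1+k]≡[1+n]*nCk n zero = ≡.trans (ℕ.*-identityˡ _)
    (≡.trans (nC1≡n (suc n)) (≡.sym (ℕ.*-identityʳ (suc n))))
  [1+k]*[1+n]C[1+k]≡[1+n]*nCk zero (suc k) = begin
    suc (suc k) * (1 C suc (suc k)) ≡⟨ ≡.cong (suc (suc k) *_) (k>n⇒nCk≡0 (s<s (z<s {k}))) ⟩
    suc (suc k) * 0                 ≡⟨ ℕ.*-zeroʳ (suc (suc k)) ⟩
    0                               ≡⟨ k>n⇒nCk≡0 (z<s {k}) ⟨
    0 C suc k                       ≡⟨ ℕ.*-identityˡ _ ⟨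
    1 * (0 C suc k)                 ∎
    where open ≡.≡-Reasoning
  [1+k]*[1+n]C[1+k]≡[1+n]*nCk (suc n) (suc k) = begin
    suc (suc k) * (suc (suc n) C suc (suc k))
      ≡⟨ ≡.cong (suc (suc k) *_) (nCk+nC[k+1]≡[n+1]C[k+1] (suc n) (suc k)) ⟨
    suc (suc k) * (x + y)
      ≡⟨ expand k x y ⟩
    x + (suc k * x + suc (suc k) * y)
      ≡⟨ ≡.cong (x +_) (≡.cong₂ _+_ ([1+k]*[1+n]C[1+k]≡[1+n]*nCk n k)
                                    ([1+k]*[1+n]C[1+k]≡[1+n]*nCk n (suc k))) ⟩
    x + (suc n * (n C k) + suc n * (n C suc k))
      ≡⟨ ≡.cong (x +_) (ℕ.*-distribˡ-+ (suc n) (n C k) (n C suc k)) ⟨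
    x + suc n * (n C k + n C suc k)
      ≡⟨ ≡.cong (λ z → x + suc n * z) (nCk+nC[k+1]≡[n+1]C[k+1] n k) ⟩
    suc (suc n) * x ∎
    where
    open ≡.≡-Reasoning
    x y : ℕ
    x = suc n C suc k
    y = suc n C suc (suc k)
    expand : ∀ k x y → suc (suc k) * (x + y) ≡ x + (suc k * x + suc (suc k) * y)
    expand = solve-∀

  module _ {p : ℕ} (pr : Prime p) where
    private instance
      p≢0 : NonZero p
      p≢0 = prime⇒nonZero pr

    p^e≢0 : ∀ e → NonZero (p ^ e)
    p^e≢0 e = ℕ.m^n≢0 p e

    p∤1 : ¬ p ∣ 1
    p∤1 p∣1 = ℕ.nonTrivial⇒≢1 {{prime⇒nonTrivial pr}} (∣.∣1⇒≡1 p∣1)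

    p^e∣i*c⇒p^e∣i : ∀ e {i c} → ¬ p ∣ c → p ^ e ∣ i * c → p ^ e ∣ i
    p^e∣i*c⇒p^e∣i zero {i} p∤c _ = ∣.1∣ i
    p^e∣i*c⇒p^e∣i (suc e) {i} {c} p∤c d with euclidsLemma i c pr (∣.∣-trans (∣.m∣m*n (p ^ e)) d)
    ... | inj₂ p∣c = contradiction p∣c p∤c
    ... | inj₁ (divides i′ ≡.refl) =
      ≡.subst (p ^ suc e ∣_) (ℕ.*-comm p i′)
        (∣.*-monoʳ-∣ p (p^e∣i*c⇒p^e∣i e p∤c
          (∣.*-cancelˡ-∣ p (≡.subst (p ^ suc e ∣_) (rearrange i′ p c) d))))
      where
      rearrange : ∀ i p c → i * p * c ≡ p * (i * c)
      rearrange = solve-∀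

    -- Since i C(n, i) = n C(n - 1, i - 1), if p did not divide C(n, i) then p^e would divide i,
    -- which lies strictly between 0 and p^e.
    p∣nCi : ∀ e {n i} → p ^ e ∣ n → 0 < i → i < p ^ e → p ∣ n C i
    p∣nCi e {zero} {i} _ 0<i _ = ≡.subst (p ∣_) (≡.sym (k>n⇒nCk≡0 0<i)) (p ∣.∣0)
    p∣nCi e {suc n} {suc i} p^e∣n _ i<p^e with p ∣? (suc n C suc i)
    ... | yes d = d
    ... | no p∤C = contradiction
      (∣.∣⇒≤ (p^e∣i*c⇒p^e∣i e p∤C
        (≡.subst (p ^ e ∣_) (≡.sym ([1+k]*[1+n]C[1+k]≡[1+n]*nCk n i)) (∣.∣m⇒∣m*n (n C i) p^e∣n))))
      (ℕ.<⇒≱ i<p^e)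

    -- Pascal's rule and `p∣nCi` give C(n, i + 1) ≡ -C(n, i) mod p, so these coefficients are ±1 mod
    -- p, starting from C(n, 0) = 1.
    p∤[n-1]Ci : ∀ e {n} → p ^ e ∣ suc n → ∀ i → i < p ^ e → ¬ p ∣ n C i
    p∤[n-1]Ci e p^e∣n zero _ = p∤1
    p∤[n-1]Ci e {n} p^e∣n (suc i) i<p^e p∣C = p∤[n-1]Ci e p^e∣n i (ℕ.<-trans (ℕ.n<1+n i) i<p^e)
      (∣.∣m+n∣m⇒∣n (≡.subst (p ∣_) pascal (p∣nCi e p^e∣n z<s i<p^e)) p∣C)
      where
      pascal : suc n C suc i ≡ n C suc i + n C i
      pascal = ≡.trans (≡.sym (nCk+nC[k+1]≡[n+1]C[k+1] n i)) (ℕ.+-comm (n C i) _)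

    -- C(m p^e, p^e) = m C(m p^e - 1, p^e - 1), and the second factor is prime to p. This instance
    -- of Lucas's theorem keeps the chosen Hasse derivative nonzero.
    p∤[mp^e]Cp^e : ∀ e {m} → ¬ p ∣ m → ¬ p ∣ (m * p ^ e) C (p ^ e)
    p∤[mp^e]Cp^e e {zero} p∤m = contradiction (p ∣.∣0) p∤m
    p∤[mp^e]Cp^e e {suc m} p∤m p∣C with p ^ e in eq
    ... | zero = contradiction eq (ℕ.≢-nonZero⁻¹ (p ^ e) {{p^e≢0 e}})
    ... | suc k with euclidsLemma (suc m) ((k + m * suc k) C k) pr (≡.subst (p ∣_) C≡ p∣C)
      where
      C≡ : (suc m * suc k) C suc k ≡ suc m * ((k + m * suc k) C k)
      C≡ = ℕ.*-cancelˡ-≡ _ _ (suc k) (≡.trans ([1+k]*[1+n]C[1+k]≡[1+n]*nCk (k + m * suc k) k)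
        (rearrange (suc m) (suc k) ((k + m * suc k) C k)))
        where
        rearrange : ∀ a b c → a * b * c ≡ b * (a * c)
        rearrange = solve-∀
    ... | inj₁ p∣m = p∤m p∣m
    ... | inj₂ p∣C′ = p∤[n-1]Ci e (≡.subst (_∣ suc m * suc k) (≡.sym eq) (∣.n∣m*n (suc m)))
                        k (≡.subst (k <_) (≡.sym eq) (ℕ.n<1+n k)) p∣C′

    p-adic-split : ∀ E {j} → ¬ p ^ E ∣ j → ∃ λ e → ∃ λ m → e < E × j ≡ m * p ^ e × ¬ p ∣ m
    p-adic-split zero {j} ¬d = contradiction (∣.1∣ j) ¬d
    p-adic-split (suc E) {j} ¬d with p ^ E ∣? j
    ... | no ¬d′ with p-adic-split E ¬d′
    ...   | e , m , e<E , eq , p∤m = e , m , ℕ.m<n⇒m<1+n e<E , eq , p∤m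
    p-adic-split (suc E) {j} ¬d | yes (divides m eq) =
      E , m , ℕ.n<1+n E , eq , λ p∣m → ¬d (≡.subst (p ^ suc E ∣_) (≡.sym eq) (∣.*-monoˡ-∣ (p ^ E) p∣m))

-- A polynomial of formal degree n is represented by its coefficient sequence
-- read from the top: entry j is the coefficient of xⁿ⁻ʲ.  Multiplying by x − a
-- then becomes multiplying the power series by 1 − a z, which is invertible, and
-- (x − a)ᵐ divides the polynomial iff the quotient series ends at index n − m.
-- Entry n of the quotient by 1 − a z is Horner's scheme for the value at a.
module Sequences {c ℓ} (R : CommutativeRing c ℓ) where
  open CommutativeRing R hiding (zero)
  open import Algebra.Properties.Semiring.Mult semiring
    using (×-homo-+; ×-congˡ; ×-homo-1) renaming (_×_ to _·_)
  open import Algebra.Solver.Ring.NaturalCoefficients.Default commutativeSemiring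
    using (solve; _:+_; _:*_; _:=_)
  open import Data.List.Relation.Binary.Sublist.Setoid setoid using (_⊆_; []; _∷_; _∷ʳ_)
  open import Relation.Binary.Reasoning.Setoid setoid

  Seq : Set c
  Seq = ℕ → Carrier

  infix 4 _≋_
  _≋_ : Seq → Seq → Set ℓ
  s ≋ t = ∀ j → s j ≈ t j

  infixl 6 _⊹_
  _⊹_ : Seq → Seq → Seq
  (s ⊹ t) j = s j + t j

  𝟘 𝟙 : Seq
  𝟘 _ = 0#
  𝟙 zero    = 1#
  𝟙 (suc _) = 0#

  mul div : Carrier → Seq → Seq
  mul a s zero    = s zero
  mul a s (suc j) = s (suc j) + - a * s j
  div a s zero    = s zero
  div a s (suc j) = s (suc j) + a * div a s j

  muls divs : List Carrier → Seq → Seq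
  muls L s = foldr mul s L
  divs L s = foldr div s L

  ≋-sym : ∀ {s t} → s ≋ t → t ≋ s
  ≋-sym p j = sym (p j)

  ≋-trans : ∀ {s t u} → s ≋ t → t ≋ u → s ≋ u
  ≋-trans p q j = trans (p j) (q j)

  mul-cong : ∀ {a b s t} → a ≈ b → s ≋ t → mul a s ≋ mul b t
  mul-cong a≈b s≋t zero    = s≋t zero
  mul-cong a≈b s≋t (suc j) = +-cong (s≋t (suc j)) (*-cong (-‿cong a≈b) (s≋t j))

  div-cong : ∀ {a b s t} → a ≈ b → s ≋ t → div a s ≋ div b t
  div-cong a≈b s≋t zero    = s≋t zero
  div-cong a≈b s≋t (suc j) = +-cong (s≋t (suc j)) (*-cong a≈b (div-cong a≈b s≋t j))

  mul-congʳ : ∀ a {s t} → s ≋ t → mul a s ≋ mul a t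
  mul-congʳ a = mul-cong refl

  div-congʳ : ∀ a {s t} → s ≋ t → div a s ≋ div a t
  div-congʳ a = div-cong refl

  divs-cong : ∀ L {s t} → s ≋ t → divs L s ≋ divs L t
  divs-cong []      p = p
  divs-cong (a ∷ L) p = div-congʳ a (divs-cong L p)

  -a*x+a*x≈0 : ∀ a x → - a * x + a * x ≈ 0#
  -a*x+a*x≈0 a x = trans (sym (distribʳ x (- a) a)) (trans (*-congʳ (-‿inverseˡ a)) (zeroˡ x))

  div-mul : ∀ a s → div a (mul a s) ≋ s
  div-mul a s zero    = refl
  div-mul a s (suc j) = begin
    s (suc j) + - a * s j + a * div a (mul a s) j ≈⟨ +-congˡ (*-congˡ (div-mul a s j)) ⟩
    s (suc j) + - a * s j + a * s j               ≈⟨ +-assoc _ _ _ ⟩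
    s (suc j) + (- a * s j + a * s j)             ≈⟨ +-congˡ (-a*x+a*x≈0 a (s j)) ⟩
    s (suc j) + 0#                                ≈⟨ +-identityʳ _ ⟩
    s (suc j)                                     ∎

  mul-div : ∀ a s → mul a (div a s) ≋ s
  mul-div a s zero    = refl
  mul-div a s (suc j) = begin
    s (suc j) + a * div a s j + - a * div a s j   ≈⟨ +-assoc _ _ _ ⟩
    s (suc j) + (a * div a s j + - a * div a s j) ≈⟨ +-congˡ (+-comm _ _) ⟩
    s (suc j) + (- a * div a s j + a * div a s j) ≈⟨ +-congˡ (-a*x+a*x≈0 a _) ⟩
    s (suc j) + 0#                                ≈⟨ +-identityʳ _ ⟩
    s (suc j)                                     ∎

  mul-comm : ∀ a b s → mul a (mul b s) ≋ mul b (mul a s)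
  mul-comm a b s zero          = refl
  mul-comm a b s (suc zero)    = solve 3 (λ x y z → x :+ y :+ z := x :+ z :+ y) refl _ _ _
  mul-comm a b s (suc (suc j)) =
    solve 5 (λ x y z a b → x :+ b :* y :+ a :* (y :+ b :* z) := x :+ a :* y :+ b :* (y :+ a :* z))
      refl (s (suc (suc j))) (s (suc j)) (s j) (- a) (- b)

  mul-div-comm : ∀ a b s → mul a (div b s) ≋ div b (mul a s)
  mul-div-comm a b s =
    ≋-trans (≋-sym (div-mul b (mul a (div b s))))
      (div-congʳ b (≋-trans (mul-comm b a (div b s)) (mul-congʳ a (mul-div b s))))

  mul-divs-comm : ∀ a L s → mul a (divs L s) ≋ divs L (mul a s)
  mul-divs-comm a []      s j = refl
  mul-divs-comm a (b ∷ L) s =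
    ≋-trans (mul-div-comm a b (divs L s)) (div-congʳ b (mul-divs-comm a L s))

  muls-div-comm : ∀ L b s → muls L (div b s) ≋ div b (muls L s)
  muls-div-comm []      b s j = refl
  muls-div-comm (a ∷ L) b s =
    ≋-trans (mul-congʳ a (muls-div-comm L b s)) (mul-div-comm a b (muls L s))

  divs-muls : ∀ L s → divs L (muls L s) ≋ s
  divs-muls []      s j = refl
  divs-muls (a ∷ L) s =
    ≋-trans (div-congʳ a (≋-sym (mul-divs-comm a L (muls L s))))
      (≋-trans (div-mul a (divs L (muls L s))) (divs-muls L s))

  muls-divs : ∀ L s → muls L (divs L s) ≋ s
  muls-divs []      s j = refl
  muls-divs (a ∷ L) s =
    ≋-trans (mul-congʳ a (muls-div-comm L a (divs L s)))
      (≋-trans (mul-div a (muls L (divs L s))) (muls-divs L s))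

  div-⊹ : ∀ a s t → div a (s ⊹ t) ≋ div a s ⊹ div a t
  div-⊹ a s t zero    = refl
  div-⊹ a s t (suc j) = trans (+-congˡ (*-congˡ (div-⊹ a s t j)))
    (solve 5 (λ a x y z w → x :+ y :+ a :* (z :+ w) := x :+ a :* z :+ (y :+ a :* w))
      refl a _ _ _ _)

  divs-⊹ : ∀ L s t → divs L (s ⊹ t) ≋ divs L s ⊹ divs L t
  divs-⊹ []      s t j = refl
  divs-⊹ (a ∷ L) s t = ≋-trans (div-congʳ a (divs-⊹ L s t)) (div-⊹ a (divs L s) (divs L t))

  div-scale : ∀ a u s → div a (λ j → u * s j) ≋ λ j → u * div a s j
  div-scale a u s zero    = refl
  div-scale a u s (suc j) = trans (+-congˡ (*-congˡ (div-scale a u s j)))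
    (solve 4 (λ a u x y → u :* x :+ a :* (u :* y) := u :* (x :+ a :* y)) refl a u _ _)

  div-𝟘 : ∀ a → div a 𝟘 ≋ 𝟘
  div-𝟘 a zero    = refl
  div-𝟘 a (suc j) = trans (+-identityˡ _) (trans (*-congˡ (div-𝟘 a j)) (zeroʳ a))

  divs-𝟘 : ∀ L → divs L 𝟘 ≋ 𝟘
  divs-𝟘 []      j = refl
  divs-𝟘 (a ∷ L) = ≋-trans (div-congʳ a (divs-𝟘 L)) (div-𝟘 a)

  mul-𝟘 : ∀ a → mul a 𝟘 ≋ 𝟘
  mul-𝟘 a zero    = refl
  mul-𝟘 a (suc j) = trans (+-identityˡ _) (zeroʳ (- a))

  muls-𝟘 : ∀ L → muls L 𝟘 ≋ 𝟘
  muls-𝟘 []      j = refl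
  muls-𝟘 (a ∷ L) = ≋-trans (mul-congʳ a (muls-𝟘 L)) (mul-𝟘 a)

  muls-cong : ∀ L {s t} → s ≋ t → muls L s ≋ muls L t
  muls-cong []      p = p
  muls-cong (a ∷ L) p = mul-congʳ a (muls-cong L p)

  divs≋𝟘⇒≋𝟘 : ∀ L {s} → divs L s ≋ 𝟘 → s ≋ 𝟘
  divs≋𝟘⇒≋𝟘 L {s} p =
    ≋-trans (≋-sym (muls-divs L s)) (≋-trans (muls-cong L p) (muls-𝟘 L))

  -- Congruence modulo z^m. `mul` and `div` respect it because entry j of the result depends only on
  -- entries up to j.
  Agree : ℕ → Seq → Seq → Set ℓ
  Agree m s t = ∀ j → j < m → s j ≈ t j

  agree-mul : ∀ {m} a {s t} → Agree m s t → Agree m (mul a s) (mul a t)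
  agree-mul a p zero    0<m = p zero 0<m
  agree-mul a p (suc j) j<m = +-cong (p (suc j) j<m) (*-congˡ (p j (ℕ.<-trans (ℕ.n<1+n j) j<m)))

  agree-div : ∀ {m} a {s t} → Agree m s t → Agree m (div a s) (div a t)
  agree-div a p zero    0<m = p zero 0<m
  agree-div a p (suc j) j<m =
    +-cong (p (suc j) j<m) (*-congˡ (agree-div a p j (ℕ.<-trans (ℕ.n<1+n j) j<m)))

  agree-muls : ∀ {m} L {s t} → Agree m s t → Agree m (muls L s) (muls L t)
  agree-muls []      p = p
  agree-muls (a ∷ L) p = agree-mul a (agree-muls L p)

  agree-divs : ∀ {m} L {s t} → Agree m s t → Agree m (divs L s) (divs L t)
  agree-divs []      p = p
  agree-divs (a ∷ L) p = agree-div a (agree-divs L p)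

  divs-head : ∀ L s → divs L s zero ≈ s zero
  divs-head []      s = refl
  divs-head (a ∷ L) s = divs-head L s

  -- The entries of s beyond index n − i vanish (all of them if i > n).
  Bd : ℕ → ℕ → Seq → Set ℓ
  Bd n i s = ∀ j → n < j ℕ.+ i → s j ≈ 0#

  Bd-cong : ∀ {n i s t} → s ≋ t → Bd n i s → Bd n i t
  Bd-cong p b j n<j = trans (sym (p j)) (b j n<j)

  Bd-≡ : ∀ {n i k s} → i ≡ k → Bd n i s → Bd n k s
  Bd-≡ ≡.refl b = b

  Bd-⊹ : ∀ {n i s t} → Bd n i s → Bd n i t → Bd n i (s ⊹ t)
  Bd-⊹ b c j n<j = trans (+-cong (b j n<j) (c j n<j)) (+-identityˡ 0#)

  private
    j+[m+o]≡m+[j+o] : ∀ m j o → j ℕ.+ (m ℕ.+ o) ≡ m ℕ.+ (j ℕ.+ o)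
    j+[m+o]≡m+[j+o] m j o = ≡.trans (≡.sym (ℕ.+-assoc j m o))
      (≡.trans (≡.cong (ℕ._+ o) (ℕ.+-comm j m)) (ℕ.+-assoc m j o))

  Bd-raise : ∀ m {n o s} → Bd n o s → Bd (m ℕ.+ n) (m ℕ.+ o) s
  Bd-raise m {n} {o} b j lt =
    b j (ℕ.+-cancelˡ-< m n (j ℕ.+ o) (≡.subst (m ℕ.+ n <_) (j+[m+o]≡m+[j+o] m j o) lt))

  Bd-lower : ∀ m {n o s} → Bd (m ℕ.+ n) (m ℕ.+ o) s → Bd n o s
  Bd-lower m {n} {o} b j lt =
    b j (≡.subst (m ℕ.+ n <_) (≡.sym (j+[m+o]≡m+[j+o] m j o)) (ℕ.+-monoʳ-< m lt))

  Bd-mul : ∀ {n i s} a → Bd n (suc i) s → Bd n i (mul a s)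
  Bd-mul {n} {i} a b zero    n<i = b zero (ℕ.m<n⇒m<1+n n<i)
  Bd-mul {n} {i} a b (suc j) n<j = trans
    (+-cong (b (suc j) (≡.subst (n <_) (≡.sym (ℕ.+-suc (suc j) i)) (ℕ.m<n⇒m<1+n n<j)))
            (trans (*-congˡ (b j (≡.subst (n <_) (≡.sym (ℕ.+-suc j i)) n<j))) (zeroʳ (- a))))
    (+-identityˡ 0#)

  Bd-muls : ∀ L {n o s} → Bd n (length L ℕ.+ o) s → Bd n o (muls L s)
  Bd-muls []      b = b
  Bd-muls (a ∷ L) b = Bd-mul a (Bd-muls L (Bd-≡ (≡.sym (ℕ.+-suc (length L) _)) b))

  -- The factor theorem: past index n the recursion of `div` only multiplies by a, so a zero value
  -- at index n propagates to all later entries.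
  root⇒Bd : ∀ {n s} a → Bd n 0 s → div a s n ≈ 0# → Bd n 1 (div a s)
  root⇒Bd {n} {s} a b root j n<j+1 =
    ≡.subst (λ i → div a s i ≈ 0#) (ℕ.m∸n+n≡m n≤j) (vanish (j ∸ n))
    where
    n≤j : n ≤ j
    n≤j = ℕ.s≤s⁻¹ (≡.subst (n <_) (ℕ.+-comm j 1) n<j+1)

    vanish : ∀ d → div a s (d ℕ.+ n) ≈ 0#
    vanish zero    = root
    vanish (suc d) = trans
      (+-cong (b (suc (d ℕ.+ n))
                 (≡.subst (n <_) (≡.sym (ℕ.+-identityʳ _)) (s≤s (ℕ.m≤n+m n d))))
              (trans (*-congˡ (vanish d)) (zeroʳ a)))
      (+-identityˡ 0#)

  -- Each division by an entry of K cancels a factor of L, and each factor left over raises the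
  -- degree by one. It is applied with K made of N copies of one clique vertex.
  Bd-divs-muls : ∀ {n o s K L} → K ⊆ L → Bd n (length L ℕ.+ o) s →
                 Bd n (length K ℕ.+ o) (divs K (muls L s))
  Bd-divs-muls [] b = b
  Bd-divs-muls {o = o} {s} {K} {_ ∷ L} (a ∷ʳ K⊆L) b =
    Bd-cong (mul-divs-comm a K (muls L s))
      (Bd-mul a (Bd-≡ (ℕ.+-suc (length K) o)
        (Bd-divs-muls K⊆L (Bd-≡ (≡.sym (ℕ.+-suc (length L) o)) b))))
  Bd-divs-muls {o = o} {s} {x ∷ K} {y ∷ L} (x≈y ∷ K⊆L) b =
    Bd-cong (≋-sym (≋-trans (div-cong x≈y (≋-sym (mul-divs-comm y K (muls L s))))
                            (div-mul y (divs K (muls L s)))))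
      (Bd-≡ (ℕ.+-suc (length K) o)
        (Bd-divs-muls K⊆L (Bd-≡ (≡.sym (ℕ.+-suc (length L) o)) b)))

  -- Hasse derivatives.

  choose : ℕ → ℕ → Carrier
  choose n k = (n C k) · 1#

  choose-pascal : ∀ n k → choose n k + choose n (suc k) ≈ choose (suc n) (suc k)
  choose-pascal n k = trans (sym (×-homo-+ 1# (n C k) (n C suc k)))
    (×-congˡ (nCk+nC[k+1]≡[n+1]C[k+1] n k))

  -- The k-th Hasse derivative of a polynomial of formal degree n: xⁿ⁻ʲ becomes
  -- (n−j choose k) xⁿ⁻ʲ⁻ᵏ, so that the formal degree becomes n − k.
  hasse : ℕ → ℕ → Seq → Seq
  hasse n k s j = choose (n ∸ j) k * s j

  hasse-0 : ∀ n s → hasse n 0 s ≋ s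
  hasse-0 n s j = trans (*-congʳ (×-homo-1 1#)) (*-identityˡ (s j))

  -- For j > n the truncated difference is below k, so the binomial coefficient is 0 whatever s is;
  -- for k = 0 it would be C(0, 0) = 1.
  Bd-hasse : ∀ n k .{{_ : NonZero k}} s → Bd n 0 (hasse (k ℕ.+ n) k s)
  Bd-hasse n k s j n<j = trans (*-congʳ (×-congˡ (k>n⇒nCk≡0 (ℕ.m<n+o⇒m∸n<o (k ℕ.+ n) j lt)))) (zeroˡ (s j))
    where
    lt : k ℕ.+ n < j ℕ.+ k
    lt = ≡.subst (k ℕ.+ n <_) (ℕ.+-comm k j)
           (ℕ.+-monoʳ-< k (≡.subst (n <_) (ℕ.+-identityʳ j) n<j))

  -- The Leibniz rule, with only two summands because x - a has first Hasse derivative 1 and none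
  -- beyond. The bound on s covers the indices where `n ∸ j` truncates and Pascal's rule may fail.
  hasse-mul : ∀ n k a s → Bd n 0 s →
    hasse (suc n) (suc k) (mul a s) ≋ mul a (hasse n (suc k) s) ⊹ hasse n k s
  hasse-mul n k a s b zero = trans (*-congʳ (sym (choose-pascal n k)))
    (trans (distribʳ _ _ _) (+-comm _ _))
  hasse-mul n k a s b (suc j) = begin
    C₁ * (s (suc j) + - a * s j)
      ≈⟨ distribˡ _ _ _ ⟩
    C₁ * s (suc j) + C₁ * (- a * s j)
      ≈⟨ +-congʳ pascal ⟩
    (C₂ + C₃) * s (suc j) + C₁ * (- a * s j)
      ≈⟨ solve 6 (λ c₁ c₂ c₃ n x y → (c₂ :+ c₃) :* x :+ c₁ :* (n :* y)
                                  := c₃ :* x :+ n :* (c₁ :* y) :+ c₂ :* x)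
           refl C₁ C₂ C₃ (- a) (s (suc j)) (s j) ⟩
    C₃ * s (suc j) + - a * (C₁ * s j) + C₂ * s (suc j) ∎
    where
    C₁ C₂ C₃ : Carrier
    C₁ = choose (n ∸ j) (suc k)
    C₂ = choose (n ∸ suc j) k
    C₃ = choose (n ∸ suc j) (suc k)

    pascal : C₁ * s (suc j) ≈ (C₂ + C₃) * s (suc j)
    pascal with suc j ℕ.≤? n
    ... | yes j<n = *-congʳ (trans (×-congˡ (≡.cong (_C suc k) (ℕ.+-∸-assoc 1 j<n)))
                                   (sym (choose-pascal (n ∸ suc j) k)))
    ... | no j≮n = trans (*-congˡ s≈0) (trans (zeroʳ C₁) (sym (trans (*-congˡ s≈0) (zeroʳ _))))
      where
      s≈0 : s (suc j) ≈ 0#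
      s≈0 = b (suc j) (≡.subst (n <_) (≡.sym (ℕ.+-identityʳ _)) (ℕ.≰⇒> j≮n))

  -- Induction on m by the Leibniz rule: a k-th derivative costs at most k of the m factors x - a.
  -- The argument w is the remaining multiplicity m - k, kept explicit to avoid truncated
  -- subtraction.
  hasse-root : ∀ m k w → m ≡ k ℕ.+ w → ∀ n a s → Bd n 0 s →
    Bd n 0 (divs (replicate w a) (hasse (m ℕ.+ n) k (muls (replicate m a) s)))
  hasse-root m zero .m ≡.refl n a s b =
    Bd-cong (≋-sym (≋-trans (divs-cong (replicate m a) (hasse-0 (m ℕ.+ n) _))
                            (divs-muls (replicate m a) s))) b
  hasse-root (suc m) (suc k) zero eq n a s b
    with ≡.refl ← ≡.trans (ℕ.suc-injective eq) (ℕ.+-identityʳ k) = Bd-hasse n (suc k) _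
  hasse-root (suc m) (suc k) (suc w) eq n a s b =
    Bd-cong (≋-sym split)
      (Bd-⊹ (hasse-root m (suc k) w (≡.trans (ℕ.suc-injective eq) (ℕ.+-suc k w)) n a s b)
            (hasse-root m k (suc w) (ℕ.suc-injective eq) n a s b))
    where
    N : ℕ
    N = m ℕ.+ n
    aʷ : List Carrier
    aʷ = replicate w a
    P : Seq
    P = muls (replicate m a) s
    Bd-P : Bd N 0 P
    Bd-P = Bd-muls (replicate m a)
      (Bd-≡ (≡.cong (ℕ._+ 0) (≡.sym (length-replicate m))) (Bd-raise m b))
    split : divs (a ∷ aʷ) (hasse (suc N) (suc k) (mul a P)) ≋
            divs aʷ (hasse N (suc k) P) ⊹ divs (a ∷ aʷ) (hasse N k P)
    split = ≋-trans (divs-cong (a ∷ aʷ) (hasse-mul N k a P Bd-P))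
      (≋-trans (divs-⊹ (a ∷ aʷ) (mul a (hasse N (suc k) P)) (hasse N k P))
        (λ j → +-congʳ (≋-trans (div-congʳ a (≋-sym (mul-divs-comm a aʷ _))) (div-mul a _) j)))

-- Finite fields: characteristic, the identity a^q = a, and root counting.

module FieldSequences {c ℓ q} (F : FiniteField c ℓ q) where
  open FiniteField F hiding (zero)
  open Sequences commutativeRing public
  open import Algebra.Properties.Ring ring
    using (-‿distribˡ-*; +-cancelˡ)
  open import Algebra.Properties.Group +-group
    using () renaming (x∙y⁻¹≈ε⇒x≈y to x-y≈0⇒x≈y)
  open import Algebra.Properties.Semiring.Mult semiring
    using (×-congˡ; ×-homo-1; ×1-homo-*) renaming (_×_ to _·_)
  open import Algebra.Properties.Semiring.Exp semiring
    using (^-congʳ) renaming (_^_ to _↑_)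
  open import Algebra.Properties.CommutativeMonoid.Sum +-commutativeMonoid
    using (sum; sum-permute; sum-cong-≋; ∑-distrib-+; sum-replicate)
  open import Algebra.Properties.CommutativeMonoid.Sum *-commutativeMonoid
    using () renaming (sum to prod; sum-permute to prod-permute; sum-cong-≋ to prod-cong;
      ∑-distrib-+ to prod-distrib-*; sum-replicate to prod-replicate; sum-remove to prod-remove)
  open import Relation.Binary.Reasoning.Setoid setoid

  *-cancelˡ-nonzero : ∀ {x y z} → ¬ x ≈ 0# → x * y ≈ x * z → y ≈ z
  *-cancelˡ-nonzero {x} {y} {z} x≉0 xy≈xz = begin
    y               ≈⟨ undo y ⟨
    x ⁻¹ * (x * y)  ≈⟨ *-congˡ xy≈xz ⟩
    x ⁻¹ * (x * z)  ≈⟨ undo z ⟩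
    z               ∎
    where
    undo : ∀ w → x ⁻¹ * (x * w) ≈ w
    undo w = trans (sym (*-assoc _ _ _))
      (trans (*-congʳ (trans (*-comm _ _) (⁻¹-inverse x x≉0))) (*-identityˡ w))

  xy≈0⇒y≈0 : ∀ {x y} → ¬ x ≈ 0# → x * y ≈ 0# → y ≈ 0#
  xy≈0⇒y≈0 {x} x≉0 xy≈0 = *-cancelˡ-nonzero x≉0 (trans xy≈0 (sym (zeroʳ x)))

  xy≉0 : ∀ {x y} → ¬ x ≈ 0# → ¬ y ≈ 0# → ¬ x * y ≈ 0#
  xy≉0 x≉0 y≉0 xy≈0 = y≉0 (xy≈0⇒y≈0 x≉0 xy≈0)

  x↑n≈0⇒x≈0 : ∀ {x} n → x ↑ n ≈ 0# → x ≈ 0#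
  x↑n≈0⇒x≈0 zero    1≈0 = contradiction (sym 1≈0) 0≉1
  x↑n≈0⇒x≈0 {x} (suc n) eq with x ≈? 0#
  ... | yes x≈0 = x≈0
  ... | no  x≉0 = x↑n≈0⇒x≈0 n (xy≈0⇒y≈0 x≉0 eq)

  carrierPermutation : (f g : Carrier → Carrier) →
    (∀ {x y} → x ≈ y → f x ≈ f y) → (∀ {x y} → x ≈ y → g x ≈ g y) →
    (∀ x → f (g x) ≈ x) → (∀ x → g (f x) ≈ x) → Permutation q q
  carrierPermutation f g f-cong g-cong fg gf =
    permutation (to ∘ f ∘ from) (to ∘ g ∘ from) (inv f-cong fg) (inv g-cong gf)
    where
    inv : ∀ {f g : Carrier → Carrier} → (∀ {x y} → x ≈ y → f x ≈ f y) → (∀ x → f (g x) ≈ x) →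
          ∀ i → to (f (from (to (g (from i))))) ≡ i
    inv f-cong fg i = ≡.trans (to-cong (trans (f-cong (from-to _)) (fg (from i)))) (inverseˡ refl)

  -- Translation by 1 permutes the field, so the sum of all elements equals itself plus q · 1.
  q·1≈0 : q · 1# ≈ 0#
  q·1≈0 = sym (+-cancelˡ (sum from) 0# (q · 1#) (begin
    sum from + 0#                        ≈⟨ +-identityʳ _ ⟩
    sum from                             ≈⟨ sum-permute from shift ⟩
    sum (λ i → from (shift ⟨$⟩ʳ i))      ≈⟨ sum-cong-≋ (λ i → from-to (from i + 1#)) ⟩
    sum (λ i → from i + 1#)              ≈⟨ ∑-distrib-+ from (λ _ → 1#) ⟩
    sum from + sum {q} (λ _ → 1#)        ≈⟨ +-congˡ (sum-replicate q) ⟩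
    sum from + q · 1#                    ∎))
    where
    shift : Permutation q q
    shift = carrierPermutation (_+ 1#) (_+ - 1#) +-congʳ +-congʳ
      (λ x → trans (+-assoc _ _ _) (trans (+-congˡ (-‿inverseˡ 1#)) (+-identityʳ x)))
      (λ x → trans (+-assoc _ _ _) (trans (+-congˡ (-‿inverseʳ 1#)) (+-identityʳ x)))

  prod≉0 : ∀ {n} (g : Fin n → Carrier) → (∀ i → ¬ g i ≈ 0#) → ¬ prod g ≈ 0#
  prod≉0 {zero}  g g≉0 = 0≉1 ∘ sym
  prod≉0 {suc n} g g≉0 = xy≉0 (g≉0 Fin.zero) (prod≉0 (g ∘ Fin.suc) (g≉0 ∘ Fin.suc))

  prod-constant-except : ∀ {n a} (i : Fin n) (g : Fin n → Carrier) → g i ≈ 1# →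
                         (∀ j → j ≢ i → g j ≈ a) → prod g * a ≈ a ↑ n
  prod-constant-except {suc n} {a} i g gi≈1 g≈a = begin
    prod g * a                      ≈⟨ *-congʳ (prod-remove {i = i} g) ⟩
    g i * prod (removeAt g i) * a   ≈⟨ *-congʳ (*-congʳ gi≈1) ⟩
    1# * prod (removeAt g i) * a    ≈⟨ *-congʳ (*-identityˡ _) ⟩
    prod (removeAt g i) * a         ≈⟨ *-congʳ (prod-cong (λ j → g≈a _ (Fin.punchInᵢ≢i i j))) ⟩
    prod {n} (λ _ → a) * a          ≈⟨ *-congʳ (prod-replicate n) ⟩
    a ↑ n * a                       ≈⟨ *-comm _ _ ⟩
    a ↑ suc n                       ∎

  -- Multiplication by a ≠ 0 permutes the nonzero elements, so it fixes their product.
  a↑q≈a : ∀ a → a ↑ q ≈ a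
  a↑q≈a a = trans (sym (prod-constant-except (to 0#) (factor ∘ from) at-0 off-0)) prod*a≈a
    where
    -- The value 1 at the zero element lets both products run over all of `Fin q`. The extra factor
    -- a in `prod-constant-except` makes up for that entry and turns a^(q - 1) into a^q.
    nonzero factor : Carrier → Carrier
    nonzero x with x ≈? 0#
    ... | yes _ = 1#
    ... | no  _ = x
    factor x with x ≈? 0#
    ... | yes _ = 1#
    ... | no  _ = a

    nonzero≉0 : ∀ x → ¬ nonzero x ≈ 0#
    nonzero≉0 x with x ≈? 0#
    ... | yes _  = 0≉1 ∘ sym
    ... | no x≉0 = x≉0

    at-0 : factor (from (to 0#)) ≈ 1#
    at-0 with from (to 0#) ≈? 0#
    ... | yes _ = refl
    ... | no ≉0 = contradiction (from-to 0#) ≉0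

    off-0 : ∀ j → j ≢ to 0# → factor (from j) ≈ a
    off-0 j j≢ with from j ≈? 0#
    ... | yes ≈0 = contradiction (≡.trans (≡.sym (inverseˡ refl)) (to-cong ≈0)) j≢
    ... | no _   = refl

    nonzero-cong : ∀ {x y} → x ≈ y → nonzero x ≈ nonzero y
    nonzero-cong {x} {y} x≈y with x ≈? 0# | y ≈? 0#
    ... | yes _  | yes _  = refl
    ... | no _   | no _   = x≈y
    ... | yes x≈0 | no y≉0 = contradiction (trans (sym x≈y) x≈0) y≉0
    ... | no x≉0 | yes y≈0 = contradiction (trans x≈y y≈0) x≉0

    nonzero-* : ¬ a ≈ 0# → ∀ x → nonzero (a * x) ≈ factor x * nonzero x
    nonzero-* a≉0 x with x ≈? 0# | a * x ≈? 0#
    ... | yes _  | yes _  = sym (*-identityˡ 1#)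
    ... | no _   | no _   = refl
    ... | yes x≈0 | no ≉0 = contradiction (trans (*-congˡ x≈0) (zeroʳ a)) ≉0
    ... | no x≉0 | yes ≈0 = contradiction ≈0 (xy≉0 a≉0 x≉0)

    prod*a≈a : prod (factor ∘ from) * a ≈ a
    prod*a≈a with a ≈? 0#
    ... | yes a≈0 = trans (*-congˡ a≈0) (trans (zeroʳ _) (sym a≈0))
    ... | no  a≉0 = trans (*-congʳ prod≈1) (*-identityˡ a)
      where
      a⁻¹a≈1 : a ⁻¹ * a ≈ 1#
      a⁻¹a≈1 = trans (*-comm _ _) (⁻¹-inverse a a≉0)
      scale : Permutation q q
      scale = carrierPermutation (a *_) (a ⁻¹ *_) *-congˡ *-congˡ
        (λ x → trans (sym (*-assoc _ _ _)) (trans (*-congʳ (⁻¹-inverse a a≉0)) (*-identityˡ x)))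
        (λ x → trans (sym (*-assoc _ _ _)) (trans (*-congʳ a⁻¹a≈1) (*-identityˡ x)))
      P : Carrier
      P = prod (nonzero ∘ from)
      prod≈1 : prod (factor ∘ from) ≈ 1#
      prod≈1 = *-cancelˡ-nonzero (prod≉0 (nonzero ∘ from) (nonzero≉0 ∘ from)) (begin
        P * prod (factor ∘ from)                         ≈⟨ *-comm _ _ ⟩
        prod (factor ∘ from) * P                         ≈⟨ prod-distrib-* (factor ∘ from) (nonzero ∘ from) ⟨
        prod (λ i → factor (from i) * nonzero (from i))  ≈⟨ prod-cong (λ i → nonzero-* a≉0 (from i)) ⟨
        prod (λ i → nonzero (a * from i))                ≈⟨ prod-cong (λ i → nonzero-cong (from-to (a * from i))) ⟨
        prod (λ i → nonzero (from (scale ⟨$⟩ʳ i)))       ≈⟨ prod-permute (nonzero ∘ from) scale ⟨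
        P                                                ≈⟨ *-identityʳ P ⟨
        P * 1#                                           ∎)

  module Characteristic {p : ℕ} (pr : Prime p) where
    private instance
      p≢0 : NonZero p
      p≢0 = prime⇒nonZero pr

    [p^n]·1≈[p·1]↑n : ∀ n → (p ℕ.^ n) · 1# ≈ (p · 1#) ↑ n
    [p^n]·1≈[p·1]↑n zero    = ×-homo-1 1#
    [p^n]·1≈[p·1]↑n (suc n) = trans (×1-homo-* p (p ℕ.^ n)) (*-congˡ ([p^n]·1≈[p·1]↑n n))

    module _ {n : ℕ} (q≡p^n : q ≡ p ℕ.^ n) where

      p·1≈0 : p · 1# ≈ 0#
      p·1≈0 = x↑n≈0⇒x≈0 n
        (trans (sym ([p^n]·1≈[p·1]↑n n)) (trans (×-congˡ (≡.sym q≡p^n)) q·1≈0))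

      p∣m⇒m·1≈0 : ∀ {m} → p ∣ m → m · 1# ≈ 0#
      p∣m⇒m·1≈0 (divides k ≡.refl) = trans (×1-homo-* k p) (trans (*-congˡ p·1≈0) (zeroʳ _))

      p∤m⇒m·1≉0 : ∀ {m} → ¬ p ∣ m → ¬ m · 1# ≈ 0#
      p∤m⇒m·1≉0 {m} p∤m m·1≈0 = 0≉1 (sym (bézout (coprime-Bézout coprime)))
        where
        coprime : Coprime p m
        coprime {d} (d∣p , d∣m) with prime⇒irreducible pr d∣p
        ... | inj₁ d≡1 = d≡1
        ... | inj₂ d≡p = contradiction (≡.subst (_∣ m) d≡p d∣m) p∤m
        kill : ∀ {k} x → k · 1# ≈ 0# → (x ℕ.* k) · 1# ≈ 0#
        kill {k} x k·1≈0 = trans (×1-homo-* x k) (trans (*-congˡ k·1≈0) (zeroʳ _))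
        unit : ∀ {u v} → 1 ℕ.+ v ≡ u → u · 1# ≈ 0# → v · 1# ≈ 0# → 1# ≈ 0#
        unit {u} {v} eq u≈0 v≈0 = begin
          1#                 ≈⟨ +-identityʳ 1# ⟨
          1# + 0#            ≈⟨ +-congˡ v≈0 ⟨
          1# + v · 1#        ≈⟨ ×-congˡ eq ⟩
          u · 1#             ≈⟨ u≈0 ⟩
          0#                 ∎
        bézout : Bézout.Identity 1 p m → 1# ≈ 0#
        bézout (Bézout.+- x y eq) = unit eq (kill x p·1≈0) (kill y m·1≈0)
        bézout (Bézout.-+ x y eq) = unit eq (kill y m·1≈0) (kill x p·1≈0)

  -- Divisibility by products of distinct linear factors and their powers.

  Distinct : List Carrier → Set _
  Distinct = AllPairs (λ x y → ¬ x ≈ y)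

  Bd-undiv : ∀ {n i s} a → Bd n (suc i) (div a s) → Bd n i s
  Bd-undiv {s = s} a b = Bd-cong (mul-div a s) (Bd-mul a b)

  -- Past the truncation index the hypotheses are the recurrences s (j + 1) = a s j and s (j + 1) =
  -- b s j, whence (b - a) s j = 0. This takes the place of unique factorisation.
  Bd-coprime : ∀ {n i s a b} → ¬ a ≈ b → Bd n i (mul a s) → Bd n i (mul b s) → Bd n (suc i) s
  Bd-coprime {n} {i} {s} {a} {b} a≉b as bs j n<j = xy≈0⇒y≈0 b-a≉0 (begin
    (b + - a) * s j                                ≈⟨ distribʳ _ _ _ ⟩
    b * s j + - a * s j                            ≈⟨ +-congʳ b*s≈s′ ⟩
    s (suc j) + - a * s j                          ≈⟨ as (suc j) n<1+j ⟩
    0#                                             ∎)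
    where
    n<1+j : n < suc j ℕ.+ i
    n<1+j = ≡.subst (n <_) (ℕ.+-suc j i) n<j
    b*s≈s′ : b * s j ≈ s (suc j)
    b*s≈s′ = sym (x-y≈0⇒x≈y (s (suc j)) (b * s j)
      (trans (+-congˡ (-‿distribˡ-* b (s j))) (bs (suc j) n<1+j)))
    b-a≉0 : ¬ b + - a ≈ 0#
    b-a≉0 b-a≈0 = a≉b (sym (x-y≈0⇒x≈y b a b-a≈0))

  -- `Bd-coprime` is applied to the full quotient: multiplying it back by x - a or by x - b leaves
  -- the same claim with one factor fewer.
  Bd-divs-coprime : ∀ {n s a} m L → All (λ b → ¬ a ≈ b) L →
    Bd n m (divs (replicate m a) s) → Bd n (length L) (divs L s) →
    Bd n (m ℕ.+ length L) (divs (replicate m a) (divs L s))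
  Bd-divs-coprime zero L _ _ bL = bL
  Bd-divs-coprime (suc m) [] _ ba _ = Bd-≡ (≡.sym (ℕ.+-identityʳ (suc m))) ba
  Bd-divs-coprime {n} {s} {a} (suc m) (b ∷ L) (a≉b ∷ a≉L) ba bL =
    Bd-coprime a≉b
      (Bd-cong (≋-sym (mul-div a (divs (replicate m a) (divs (b ∷ L) s))))
        (Bd-divs-coprime m (b ∷ L) (a≉b ∷ a≉L) (Bd-undiv a ba) bL))
      (Bd-cong (≋-sym (≋-trans (mul-divs-comm b (replicate (suc m) a) (div b (divs L s)))
                               (divs-cong (replicate (suc m) a) (mul-div b (divs L s)))))
        (Bd-≡ (≡.sym (ℕ.+-suc m (length L)))
          (Bd-divs-coprime (suc m) L a≉L ba (Bd-undiv b bL))))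

  length-multiples : ∀ m (A : List Carrier) → length (concatMap (replicate m) A) ≡ length A ℕ.* m
  length-multiples m []      = ≡.refl
  length-multiples m (a ∷ A) = ≡.trans (length-++ (replicate m a))
    (≡.cong₂ ℕ._+_ (length-replicate m) (length-multiples m A))

  Bd-multiple-roots : ∀ {n s} m A → Distinct A → Bd n 0 s →
    All (λ a → Bd n m (divs (replicate m a) s)) A →
    Bd n (length (concatMap (replicate m) A)) (divs (concatMap (replicate m) A) s)
  Bd-multiple-roots m [] _ b _ = b
  Bd-multiple-roots {n} {s} m (a ∷ A) (a≉A ∷ A!) b (ra ∷ rA)
    rewrite foldr-++ div s (replicate m a) (concatMap (replicate m) A)
          | length-++ (replicate m a) {concatMap (replicate m) A}
          | length-replicate m {a} =
    Bd-divs-coprime m (concatMap (replicate m) A)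
      (All.concat⁺ (All.map⁺ (All.map (All.replicate⁺ m) a≉A)))
      ra (Bd-multiple-roots m A A! b rA)

  Bd-roots : ∀ {n s} A → Distinct A → Bd n 0 s → All (λ a → div a s n ≈ 0#) A →
             Bd n (length A) (divs A s)
  Bd-roots [] _ b _ = b
  Bd-roots (a ∷ A) (a≉A ∷ A!) b (ra ∷ rA) =
    Bd-divs-coprime 1 A a≉A (root⇒Bd a b ra) (Bd-roots A A! b rA)

  -- The polynomial x^q − x, provided that q > 1.
  frobenius : Seq
  frobenius zero = 1#
  -- The coefficient of x sits at index q - 1, counted from the top.
  frobenius (suc j) with suc (suc j) ℕ.≟ q
  ... | yes _ = - 1#
  ... | no  _ = 0#

  frobenius≈𝟙 : ∀ j → suc j < q → 𝟙 j ≈ frobenius j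
  frobenius≈𝟙 zero    _ = refl
  frobenius≈𝟙 (suc j) j+2<q with suc (suc j) ℕ.≟ q
  ... | yes eq = contradiction eq (ℕ.<⇒≢ j+2<q)
  ... | no  _  = refl

  module _ (1<q : 1 < q) where

    Bd-frobenius : Bd q 0 frobenius
    Bd-frobenius zero    ()
    Bd-frobenius (suc j) q<j with suc (suc j) ℕ.≟ q
    ... | yes ≡.refl = contradiction (≡.subst (q <_) (ℕ.+-identityʳ (suc j)) q<j) (ℕ.<-asym (ℕ.n<1+n _))
    ... | no  _  = refl

    div-𝟙 : ∀ a j → div a 𝟙 j ≈ a ↑ j
    div-𝟙 a zero    = refl
    div-𝟙 a (suc j) = trans (+-identityˡ _) (*-congˡ (div-𝟙 a j))

    frobenius-root : ∀ a → div a frobenius q ≈ 0#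
    frobenius-root a = ≡.subst (λ n → div a frobenius n ≈ 0#) q≡ (begin
      frobenius (suc (suc u)) + a * (frobenius (suc u) + a * div a frobenius u)
        ≈⟨ +-cong last (*-congˡ (+-cong middle (*-congˡ initial))) ⟩
      0# + a * (- 1# + a * a ↑ u)
        ≈⟨ +-identityˡ _ ⟩
      a * (- 1# + a * a ↑ u)
        ≈⟨ distribˡ _ _ _ ⟩
      a * - 1# + a ↑ suc (suc u)
        ≈⟨ +-cong (trans (*-comm a (- 1#)) (trans (sym (-‿distribˡ-* 1# a)) (-‿cong (*-identityˡ a))))
                  (trans (^-congʳ a q≡) (a↑q≈a a)) ⟩
      - a + a
        ≈⟨ -‿inverseˡ a ⟩
      0# ∎)
      where
      u : ℕ
      u = q ∸ 2
      q≡ : suc (suc u) ≡ q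
      q≡ = ℕ.m+[n∸m]≡n 1<q
      last : frobenius (suc (suc u)) ≈ 0#
      last with suc (suc (suc u)) ℕ.≟ q
      ... | yes eq = contradiction (≡.trans q≡ (≡.sym eq)) (ℕ.<⇒≢ (ℕ.n<1+n _))
      ... | no  _  = refl
      middle : frobenius (suc u) ≈ - 1#
      middle with suc (suc u) ℕ.≟ q
      ... | yes _ = refl
      ... | no ≢q = contradiction q≡ ≢q
      initial : div a frobenius u ≈ a ↑ u
      initial = trans (sym (agree-div {suc u} a
        (λ j j≤u → frobenius≈𝟙 j (≡.subst (suc j <_) q≡ (s<s j≤u))) u (ℕ.n<1+n u))) (div-𝟙 a u)

    Bd-divs-frobenius : ∀ L → Distinct L → Bd q (length L) (divs L frobenius)
    Bd-divs-frobenius L L! = Bd-roots L L! Bd-frobenius (All.universal frobenius-root L)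

    -- More than q roots would make even the leading entry of the quotient vanish, but that entry is
    -- the leading coefficient 1 of x^q - x.
    distinct⇒length≤q : ∀ {L} → Distinct L → length L ≤ q
    distinct⇒length≤q {L} L! = ℕ.≮⇒≥ λ q<L →
      0≉1 (trans (sym (Bd-divs-frobenius L L! zero q<L)) (divs-head L frobenius))

    -- `divs L 𝟙` is the generating series of the complete homogeneous symmetric functions of L. The
    -- -1 of x^q - x enters only at index q - 1, so earlier entries coincide with those of the
    -- quotient of x^q - x, a polynomial of degree q - |L|.
    divs-𝟙-vanish : ∀ L → Distinct L → ∀ j → suc j < q → q < j ℕ.+ length L → divs L 𝟙 j ≈ 0#
    divs-𝟙-vanish L L! j j+1<q q<j+L = trans
      (agree-divs {suc j} L (λ i i≤j → frobenius≈𝟙 i (ℕ.≤-<-trans i≤j j+1<q)) j (ℕ.n<1+n j))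
      (Bd-divs-frobenius L L! j q<j+L)

  -- Polynomial functions of the parameter y.

  -- The witness is a coefficient sequence whose Horner value is g, so that root counting applies to
  -- functions of y; k only bounds the degree.
  PolynomialFunction : ℕ → (Carrier → Carrier) → Set _
  PolynomialFunction k g = ∃ λ s → Bd k 0 s × ∀ y → g y ≈ div y s k

  polynomial-1 : PolynomialFunction 0 (λ _ → 1#)
  polynomial-1 = 𝟙 , (λ { (suc _) _ → refl ; zero () }) , λ y → refl

  polynomial-0 : ∀ k → PolynomialFunction k (λ _ → 0#)
  polynomial-0 k = 𝟘 , (λ _ _ → refl) , λ y → sym (div-𝟘 y k)

  polynomial-+ : ∀ {k g h} → PolynomialFunction k g → PolynomialFunction k h →
                 PolynomialFunction k (λ y → g y + h y)
  polynomial-+ {k} (s , bs , gs) (t , bt , ht) = s ⊹ t , Bd-⊹ bs bt , λ y →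
    trans (+-cong (gs y) (ht y)) (sym (div-⊹ y s t k))

  polynomial-linear-* : ∀ {k g} u v → PolynomialFunction k g →
                        PolynomialFunction (suc k) (λ y → (u - y * v) * g y)
  polynomial-linear-* {k} {g} u v (s , bs , gs) = s′ , bs′ , λ y → sym (begin
      div y s′ (suc k)
        ≈⟨ div-⊹ y (λ j → u * shift j) (λ j → - v * s j) (suc k) ⟩
      div y (λ j → u * shift j) (suc k) + div y (λ j → - v * s j) (suc k)
        ≈⟨ +-cong (div-scale y u shift (suc k)) (div-scale y (- v) s (suc k)) ⟩
      u * div y shift (suc k) + - v * (s (suc k) + y * div y s k)
        ≈⟨ +-cong (*-congˡ (div-shift y k)) (*-congˡ (trans (+-congʳ (bs (suc k) k<1+k+0)) (+-identityˡ _))) ⟩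
      u * div y s k + - v * (y * div y s k)
        ≈⟨ +-congˡ (trans (sym (*-assoc (- v) y _)) (*-congʳ (trans (sym (-‿distribˡ-* v y)) (-‿cong (*-comm v y))))) ⟩
      u * div y s k + - (y * v) * div y s k
        ≈⟨ distribʳ _ _ _ ⟨
      (u - y * v) * div y s k
        ≈⟨ *-congˡ (gs y) ⟨
      (u - y * v) * g y ∎)
    where
    k<1+k+0 : k < suc k ℕ.+ 0
    k<1+k+0 = ℕ.m≤m+n (suc k) 0
    -- With entries read from the top and the formal degree raised by one, a constant factor shifts
    -- the entries while a factor y leaves them in place.
    shift s′ : Seq
    shift zero    = 0#
    shift (suc j) = s j
    s′ = (λ j → u * shift j) ⊹ (λ j → - v * s j)
    div-shift : ∀ y j → div y shift (suc j) ≈ div y s j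
    div-shift y zero    = trans (+-congˡ (zeroʳ y)) (+-identityʳ (s 0))
    div-shift y (suc j) = +-congˡ (*-congˡ (div-shift y j))
    bs′ : Bd (suc k) 0 s′
    bs′ (suc j) lt = trans (+-cong (trans (*-congˡ (bs j (ℕ.s<s⁻¹ lt))) (zeroʳ u))
        (trans (*-congˡ (bs (suc j) (ℕ.<-trans (ℕ.n<1+n k) lt))) (zeroʳ (- v)))) (+-identityʳ 0#)

  -- Dividing by more than k distinct roots leaves a quotient with no entries at all, and division
  -- is invertible on series.
  polynomial-identity : ∀ {k g Y} → PolynomialFunction k g → Distinct Y → k < length Y →
                        All (λ y → g y ≈ 0#) Y → ∀ y → g y ≈ 0#
  polynomial-identity {k} {g} {Y} (s , bs , gs) Y! k<Y g≈0 y =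
    trans (gs y) (trans (div-congʳ y s≋𝟘 k) (div-𝟘 y k))
    where
    s≋𝟘 : s ≋ 𝟘
    s≋𝟘 = divs≋𝟘⇒≋𝟘 Y λ j →
      Bd-roots Y Y! bs (All.map (λ {y} g≈0 → trans (sym (gs y)) g≈0) g≈0) j
        (ℕ.<-≤-trans k<Y (ℕ.m≤n+m (length Y) j))

  line : Carrier → Carrier × Carrier → Carrier
  line y (u , v) = u - y * v

  -- The complete homogeneous symmetric function of degree j in the u − y v.
  polynomial-divs-𝟙 : ∀ ps j → PolynomialFunction j (λ y → divs (map (line y) ps) 𝟙 j)
  polynomial-divs-𝟙 [] zero    = polynomial-1
  polynomial-divs-𝟙 [] (suc j) = polynomial-0 (suc j)
  polynomial-divs-𝟙 (_ ∷ ps) zero = polynomial-divs-𝟙 ps zero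
  -- The recursion h_j(x, L) = h_j(L) + x h_(j-1)(x, L) at x = u - y v.
  polynomial-divs-𝟙 ((u , v) ∷ ps) (suc j) =
    polynomial-+ (polynomial-divs-𝟙 ps (suc j))
      (polynomial-linear-* u v (polynomial-divs-𝟙 ((u , v) ∷ ps) j))

-- The values a - y b, the polynomial G and its multiple roots.

module Directions {c ℓ q} (F : FiniteField c ℓ q) where
  open FiniteField F hiding (zero)
  open FieldSequences F
  open import Algebra.Properties.Ring ring using (-0#≈0#)
  open import Algebra.Properties.Semiring.Exp semiring
    using (^-assocʳ; ^-congˡ; ^-congʳ) renaming (_^_ to _↑_)
  open import Data.List.Relation.Binary.Sublist.Setoid setoid using (_⊆_; []; from∈)
  import Data.List.Relation.Binary.Sublist.Setoid.Properties setoid as Sublist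
  open import Relation.Binary.Reasoning.Setoid setoid

  -- A sequence supported on multiples of M comes from a polynomial in x^M: between two multiples
  -- Horner's scheme only multiplies by a.
  div-thin : ∀ {M s} a i .{{_ : NonZero M}} → (∀ j → ¬ M ∣ j → s j ≈ 0#) →
             div (a ↑ M) (λ i → s (i ℕ.* M)) i ≈ div a s (i ℕ.* M)
  div-thin a zero s≈0 = refl
  div-thin {suc M} {s} a (suc i) s≈0 = +-congˡ (begin
    a * a ↑ M * div (a ↑ suc M) (λ i → s (i ℕ.* suc M)) i ≈⟨ *-congˡ (div-thin a i s≈0) ⟩
    a * a ↑ M * div a s (i ℕ.* suc M)                      ≈⟨ *-assoc _ _ _ ⟩
    a * (a ↑ M * div a s (i ℕ.* suc M))                    ≈⟨ *-congˡ (skip M (ℕ.n<1+n M)) ⟨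
    a * div a s (M ℕ.+ i ℕ.* suc M)                        ∎)
    where
    skip : ∀ d → d < suc M → div a s (d ℕ.+ i ℕ.* suc M) ≈ a ↑ d * div a s (i ℕ.* suc M)
    skip zero    _    = sym (*-identityˡ _)
    skip (suc d) d<M = trans
      (+-cong (s≈0 _ λ M∣ → ℕ.<⇒≱ d<M (∣.∣⇒≤ (∣.∣m+n∣m⇒∣n (≡.subst (suc M ∣_) (ℕ.+-comm (suc d) _) M∣) (∣.n∣m*n i))))
              (*-congˡ (skip d (ℕ.<-trans (ℕ.n<1+n d) d<M))))
      (trans (+-identityˡ _) (sym (*-assoc _ _ _)))

  Bd-first-root : ∀ {m n s a} → Fin m → Bd n m (divs (replicate m a) s) → Bd n 1 (div a s)
  Bd-first-root {suc zero}            _ b = b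
  Bd-first-root {suc (suc m)} {a = a} _ b = Bd-first-root {suc m} Fin.zero (Bd-undiv a b)

  module _ {N : ℕ} (f : Fin N → Carrier) where

    pairs : List (Carrier × Carrier)
    pairs = cartesianProductWith (λ j i → f i , f j) (allFin N) (allFin N)

    values : Carrier → List Carrier
    values y = map (line y) pairs

    length-allFin : length (allFin N) ≡ N
    length-allFin = length-tabulate (λ i → i)

    length-values : ∀ y → length (values y) ≡ N ℕ.* N
    length-values y = ≡.trans (length-map (line y) pairs)
      (≡.trans (count (allFin N)) (≡.cong₂ ℕ._*_ length-allFin length-allFin))
      where
      count : ∀ J → length (cartesianProductWith (λ j i → f i , f j) J (allFin N)) ≡
                    length J ℕ.* length (allFin N)
      count []      = ≡.refl
      count (j ∷ J) = ≡.trans (length-++ (map (λ i → f i , f j) (allFin N)))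
        (≡.cong₂ ℕ._+_ (length-map (λ i → f i , f j) (allFin N)) (count J))

    InjectiveAt : Carrier → Set _
    InjectiveAt y = ∀ i j i′ j′ → f i - y * f j ≈ f i′ - y * f j′ → j ≡ j′ × i ≡ i′

    values-distinct : ∀ {y} → InjectiveAt y → Distinct (values y)
    values-distinct {y} inj = AllPairs.map⁺
      (Unique.cartesianProductWith⁺ (≡.setoid (Fin N)) (≡.setoid (Fin N)) (On.setoid setoid (line y))
        (λ j i → f i , f j) (λ {j} {j′} {i} {i′} → inj i j i′ j′) (Unique.allFin⁺ N) (Unique.allFin⁺ N))

    -- The second coordinate is the outer index of `pairs`, so at y = 0 each of the N blocks is a
    -- copy of the clique and contributes f i once.
    replicate⊆values-0 : ∀ i → replicate N (f i) ⊆ values 0#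
    replicate⊆values-0 i = ≡.subst (λ n → replicate n (f i) ⊆ values 0#) length-allFin (go (allFin N))
      where
      fi≈ : ∀ j → f i ≈ f i - 0# * f j
      fi≈ j = sym (trans (+-congˡ (trans (-‿cong (zeroˡ (f j))) -0#≈0#)) (+-identityʳ (f i)))
      go : ∀ J → replicate (length J) (f i) ⊆
                 map (line 0#) (cartesianProductWith (λ j i → f i , f j) J (allFin N))
      go [] = []
      go (j ∷ J) = ≡.subst (f i ∷ replicate (length J) (f i) ⊆_)
        (≡.sym (map-++ (line 0#) (map (λ i → f i , f j) (allFin N)) _))
        (Sublist.++⁺ (from∈ (Any.map⁺ (Any.map⁺ (Any.map (λ { ≡.refl → fi≈ j }) (∈-allFin i))))) (go J))

    module _ {p r : ℕ} (pr : Prime p) (q≡ : q ≡ p ℕ.^ (2 ℕ.* r ℕ.+ 1)) (1<q : 1 < q)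
             (f-injective : ∀ {i j} → f i ≈ f j → i ≡ j)
             (Y : List Carrier) (Y! : Distinct Y) (0<Y : 0 < length Y) (Y<q : length Y < q)
             (Y-injective : All InjectiveAt Y) where

      open Characteristic pr using (p∣m⇒m·1≈0; p∤m⇒m·1≉0)
      open PrimePowerBinomials
      private instance
        p≢0 : NonZero p
        p≢0 = prime⇒nonZero pr

      N*N≤q : N ℕ.* N ≤ q
      N*N≤q = go Y-injective 0<Y
        where
        go : ∀ {Y} → All InjectiveAt Y → 0 < length Y → N ℕ.* N ≤ q
        go {y ∷ _} (inj ∷ _) _ =
          ≡.subst (_≤ q) (length-values y) (distinct⇒length≤q 1<q (values-distinct inj))

      N≤q : N ≤ q
      N≤q = ℕ.≤-trans (square N) N*N≤q
        where
        square : ∀ n → n ≤ n ℕ.* n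
        square zero    = z≤n
        square (suc n) = ℕ.m≤m*n (suc n) (suc n)

      values-0-vanish : ∀ j → j < length Y → q < j ℕ.+ N ℕ.* N → divs (values 0#) 𝟙 j ≈ 0#
      values-0-vanish j j<Y q<j =
        polynomial-identity (polynomial-divs-𝟙 pairs j) Y! j<Y
          (All.map (λ {y} inj → divs-𝟙-vanish 1<q (values y) (values-distinct inj) j
              (ℕ.≤-<-trans j<Y Y<q)
              (≡.subst (λ n → q < j ℕ.+ n) (≡.sym (length-values y)) q<j))
            Y-injective) 0#

      -- Modulo z^|Y| the series divs (values 0#) 𝟙 is a polynomial of degree at most
      -- q − N², so that G = ∏ (x − f i)ᴺ · cofactor is x^q + (terms of degree ≤ q − |Y|).
      cofactor G : Seq
      cofactor j with j ℕ.+ N ℕ.* N ℕ.≤? q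
      ... | yes _ = divs (values 0#) 𝟙 j
      ... | no  _ = 0#
      G = muls (values 0#) cofactor

      Bd-cofactor : Bd q (N ℕ.* N) cofactor
      Bd-cofactor j q<j with j ℕ.+ N ℕ.* N ℕ.≤? q
      ... | yes j≤q = contradiction j≤q (ℕ.<⇒≱ q<j)
      ... | no  _   = refl

      cofactor≈ : Agree (length Y) cofactor (divs (values 0#) 𝟙)
      cofactor≈ j j<Y with j ℕ.+ N ℕ.* N ℕ.≤? q
      ... | yes _   = refl
      ... | no  j≰q = sym (values-0-vanish j j<Y (ℕ.≰⇒> j≰q))

      G≈𝟙 : Agree (length Y) G 𝟙
      G≈𝟙 j j<Y = trans (agree-muls (values 0#) cofactor≈ j j<Y) (muls-divs (values 0#) 𝟙 j)

      Bd-cofactor′ : Bd q (length (values 0#) ℕ.+ 0) cofactor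
      Bd-cofactor′ = Bd-≡ (≡.sym (≡.trans (ℕ.+-identityʳ _) (length-values 0#))) Bd-cofactor

      Bd-G : Bd q 0 G
      Bd-G = Bd-muls (values 0#) Bd-cofactor′

      G-root : ∀ i → Bd q N (divs (replicate N (f i)) G)
      G-root i = Bd-≡ (≡.trans (ℕ.+-identityʳ _) (length-replicate N))
        (Bd-divs-muls (replicate⊆values-0 i) Bd-cofactor′)

      A : List Carrier
      A = map f (allFin N)

      length-A : length A ≡ N
      length-A = ≡.trans (length-map f (allFin N)) length-allFin

      p^r*p^[1+r]≡q : p ℕ.^ r ℕ.* p ℕ.^ suc r ≡ q
      p^r*p^[1+r]≡q = ≡.trans (≡.sym (ℕ.^-distribˡ-+-* p r (suc r)))
        (≡.trans (≡.cong (p ℕ.^_) exponent) (≡.sym q≡))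
        where
        exponent : r ℕ.+ suc r ≡ 2 ℕ.* r ℕ.+ 1
        exponent = ≡.trans (ℕ.+-suc r r)
          (≡.trans (≡.cong (λ n → suc (r ℕ.+ n)) (≡.sym (ℕ.+-identityʳ r))) (ℕ.+-comm 1 _))

      -- Here G is a polynomial of degree p^r in x^(p^(r+1)), and raising to the power
      -- p^(r+1) is injective because x^q = x.
      sparse⇒N≤p^r : (∀ j → ¬ p ℕ.^ suc r ∣ j → G j ≈ 0#) → N ≤ p ℕ.^ r
      sparse⇒N≤p^r sparse = ℕ.≮⇒≥ λ t<N → 0≉1 (begin
        0#                 ≈⟨ Bd-roots Aᴹ Aᴹ! Bd-thin roots zero (≡.subst (t <_) (≡.sym length-Aᴹ) t<N) ⟨
        divs Aᴹ thin 0     ≈⟨ divs-head Aᴹ thin ⟩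
        G 0                ≈⟨ G≈𝟙 0 0<Y ⟩
        1#                 ∎)
        where
        M t : ℕ
        M = p ℕ.^ suc r
        t = p ℕ.^ r
        instance
          M≢0 : NonZero M
          M≢0 = ℕ.m^n≢0 p (suc r)
        t*M≡q : t ℕ.* M ≡ q
        t*M≡q = p^r*p^[1+r]≡q
        thin : Seq
        thin i = G (i ℕ.* M)
        Bd-thin : Bd t 0 thin
        Bd-thin i t<i = Bd-G (i ℕ.* M)
          (≡.subst₂ _<_ t*M≡q (≡.sym (ℕ.+-identityʳ _)) (ℕ.*-monoˡ-< M (≡.subst (t <_) (ℕ.+-identityʳ i) t<i)))
        Aᴹ : List Carrier
        Aᴹ = map (λ i → f i ↑ M) (allFin N)
        length-Aᴹ : length Aᴹ ≡ N
        length-Aᴹ = ≡.trans (length-map _ (allFin N)) length-allFin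
        ↑M↑t : ∀ a → (a ↑ M) ↑ t ≈ a
        ↑M↑t a = trans (^-assocʳ a M t) (trans (^-congʳ a (≡.trans (ℕ.*-comm M t) t*M≡q)) (a↑q≈a a))
        Aᴹ! : Distinct Aᴹ
        Aᴹ! = AllPairs.map⁺ (AllPairs.map (λ {i} {j} i≢j fᴹ≈ → i≢j (f-injective
          (trans (sym (↑M↑t (f i))) (trans (^-congˡ t fᴹ≈) (↑M↑t (f j)))))) (Unique.allFin⁺ N))
        root : ∀ i → div (f i) G q ≈ 0#
        root i = Bd-first-root i (G-root i) q (ℕ.≤-reflexive (ℕ.+-comm 1 q))
        roots : All (λ a → div a thin t ≈ 0#) Aᴹ
        roots = All.map⁺ (All.universal (λ i → trans (div-thin (f i) t sparse)
          (trans (reflexive (≡.cong (div (f i) G) t*M≡q)) (root i))) (allFin N))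

      -- Some term of G has exponent m p^e with e ≤ r and p not dividing m, so the Hasse derivative
      -- of order k = p^e is nonzero. Its degree, at most q - |Y| - k, must leave room for N roots
      -- of multiplicity w = N - k.
      nonsparse⇒bound : ∀ {j} → ¬ G j ≈ 0# → j ≤ q → ¬ p ℕ.^ suc r ∣ q ∸ j →
        N ≤ p ℕ.^ r ⊎ ∃ λ k → ∃ λ w → k ≤ p ℕ.^ r × N ≡ k ℕ.+ w × length Y ℕ.+ N ℕ.* w ℕ.+ k ≤ q
      nonsparse⇒bound {j} Gj≉0 j≤q ∤q-j with p-adic-split pr (suc r) ∤q-j
      ... | e , m , e<r+1 , q-j≡ , p∤m with p ℕ.^ e ℕ.≤? N
      -- Differentiating more than N times leaves no multiplicity to count, but then N < p^e ≤ p^r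
      -- already.
      ...   | no  k≰N = inj₁ (ℕ.≤-trans (ℕ.<⇒≤ (ℕ.≰⇒> k≰N)) (ℕ.^-monoʳ-≤ p (ℕ.s≤s⁻¹ e<r+1)))
      ...   | yes k≤N = inj₂ (k , w , k≤t , N≡k+w , ℕ.≮⇒≥ λ q< → derivative≉0 (derivative≋𝟘 q< j))
        where
        k w n n′ : ℕ
        k = p ℕ.^ e
        w = N ∸ k
        n = q ∸ N
        n′ = w ℕ.+ n
        k≤t : k ≤ p ℕ.^ r
        k≤t = ℕ.^-monoʳ-≤ p (ℕ.s≤s⁻¹ e<r+1)
        N≡k+w : N ≡ k ℕ.+ w
        N≡k+w = ≡.sym (ℕ.m+[n∸m]≡n k≤N)
        N+n≡q : N ℕ.+ n ≡ q
        N+n≡q = ℕ.m+[n∸m]≡n N≤q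
        k+n′≡q : k ℕ.+ n′ ≡ q
        k+n′≡q = ≡.trans (≡.sym (ℕ.+-assoc k w n)) (≡.trans (≡.cong (ℕ._+ n) (≡.sym N≡k+w)) N+n≡q)
        instance
          k≢0 : NonZero k
          k≢0 = ℕ.m^n≢0 p e
        derivative : Seq
        derivative = hasse q k G

        derivative≉0 : ¬ derivative j ≈ 0#
        derivative≉0 = xy≉0 (p∤m⇒m·1≉0 {2 ℕ.* r ℕ.+ 1} q≡
          (≡.subst (λ n → ¬ p ∣ n C k) (≡.sym q-j≡) (p∤[mp^e]Cp^e pr e p∤m))) Gj≉0

        Bd-derivative : Bd n′ 0 derivative
        Bd-derivative = ≡.subst (λ q → Bd n′ 0 (hasse q k G)) k+n′≡q (Bd-hasse n′ k G)

        derivative-root : ∀ i → Bd n′ w (divs (replicate w (f i)) derivative)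
        derivative-root i = Bd-≡ (ℕ.+-identityʳ w) (Bd-raise w (Bd-cong
          (divs-cong (replicate w (f i)) λ j → *-congˡ (muls-divs (replicate N (f i)) G j))
          (≡.subst (λ q → Bd n 0 (divs (replicate w (f i))
              (hasse q k (muls (replicate N (f i)) (divs (replicate N (f i)) G)))))
            N+n≡q
            (hasse-root N k w N≡k+w n (f i) (divs (replicate N (f i)) G)
              (Bd-lower N (≡.subst (λ q → Bd q (N ℕ.+ 0) (divs (replicate N (f i)) G)) (≡.sym N+n≡q)
                (Bd-≡ (≡.sym (ℕ.+-identityʳ N)) (G-root i))))))))

        derivative-low : Agree (length Y) derivative 𝟘
        -- The term x^q is killed because p divides C(q, k) for 0 < k < q, and e ≤ r keeps k below
        -- q.
        derivative-low zero _ = trans (*-congʳ (p∣m⇒m·1≈0 {2 ℕ.* r ℕ.+ 1} q≡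
            (p∣nCi pr (2 ℕ.* r ℕ.+ 1) (∣.∣-reflexive (≡.sym q≡)) (ℕ.>-nonZero⁻¹ k) k<q))) (zeroˡ _)
          where
          k<q : k < p ℕ.^ (2 ℕ.* r ℕ.+ 1)
          k<q = ℕ.^-monoʳ-< p (ℕ.nonTrivial⇒n>1 p {{prime⇒nonTrivial pr}})
            (ℕ.<-≤-trans e<r+1 (≡.subst (_≤ 2 ℕ.* r ℕ.+ 1) (ℕ.+-comm r 1) (ℕ.+-monoˡ-≤ 1 (ℕ.m≤m+n r (r ℕ.+ 0)))))
        derivative-low (suc i) i<Y = trans (*-congˡ (G≈𝟙 (suc i) i<Y)) (zeroʳ _)

        Aʷ : List Carrier
        Aʷ = concatMap (replicate w) A
        length-Aʷ : length Aʷ ≡ N ℕ.* w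
        length-Aʷ = ≡.trans (length-multiples w A) (≡.cong (ℕ._* w) length-A)

        A! : Distinct A
        A! = AllPairs.map⁺ (AllPairs.map (λ i≢j fi≈fj → i≢j (f-injective fi≈fj)) (Unique.allFin⁺ N))

        derivative≋𝟘 : q < length Y ℕ.+ N ℕ.* w ℕ.+ k → derivative ≋ 𝟘
        derivative≋𝟘 q< = divs≋𝟘⇒≋𝟘 Aʷ vanish
          where
          n′<Y+Nw : n′ < length Y ℕ.+ N ℕ.* w
          n′<Y+Nw = ℕ.+-cancelʳ-< k n′ _ (≡.subst (_< length Y ℕ.+ N ℕ.* w ℕ.+ k)
            (≡.trans (≡.sym k+n′≡q) (ℕ.+-comm k n′)) q<)
          -- Entries below |Y| vanish because G begins like x^q, all later ones because the roots
          -- exhaust the degree.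
          vanish : divs Aʷ derivative ≋ 𝟘
          vanish i with i ℕ.<? length Y
          ... | yes i<Y = trans (agree-divs Aʷ derivative-low i i<Y) (divs-𝟘 Aʷ i)
          ... | no  i≮Y = Bd-multiple-roots w A A! Bd-derivative
            (All.map⁺ (All.universal derivative-root (allFin N))) i
            (≡.subst (λ n → n′ < i ℕ.+ n) (≡.sym length-Aʷ)
              (ℕ.<-≤-trans n′<Y+Nw (ℕ.+-monoˡ-≤ (N ℕ.* w) (ℕ.≮⇒≥ i≮Y))))

      direction-bound :
        N ≤ p ℕ.^ r ⊎ ∃ λ k → ∃ λ w → k ≤ p ℕ.^ r × N ≡ k ℕ.+ w × length Y ℕ.+ N ℕ.* w ℕ.+ k ≤ q
      direction-bound
        with ℕ.anyUpTo? (λ j → ¬? (G j ≈? 0#) ×-dec ¬? (p ℕ.^ suc r ∣? q ∸ j)) (suc q)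
      ... | yes (j , j<1+q , Gj≉0 , ∤) = nonsparse⇒bound Gj≉0 (ℕ.s≤s⁻¹ j<1+q) ∤
      ... | no none = inj₁ (sparse⇒N≤p^r sparse)
        where
        M∣q : p ℕ.^ suc r ∣ q
        M∣q = divides (p ℕ.^ r) (≡.sym p^r*p^[1+r]≡q)
        -- Since p^(r+1) divides q, it divides the index j whenever it divides the exponent q - j.
        sparse : ∀ j → ¬ p ℕ.^ suc r ∣ j → G j ≈ 0#
        sparse j M∤j with j ℕ.≤? q
        ... | no  j≰q = Bd-G j (≡.subst (q <_) (≡.sym (ℕ.+-identityʳ j)) (ℕ.≰⇒> j≰q))
        ... | yes j≤q = decidable-stable (G j ≈? 0#) λ Gj≉0 → none (j , s≤s j≤q , Gj≉0 , λ M∣q-j →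
          M∤j (∣.∣m+n∣m⇒∣n (≡.subst (_ ∣_) (≡.sym (ℕ.m∸n+n≡m j≤q)) M∣q) M∣q-j))

-- Cardinalities of decidable subsets.

module Counting where
  private variable
    a p₁ p₂ p₃ : Level
    A : Set a

  length-filter-∷ : {P : Pred A p₁} (P? : Decidable P) → ∀ x xs →
                    length (filter P? xs) ≤ length (filter P? (x ∷ xs))
  length-filter-∷ P? x xs with P? x
  ... | yes _ = ℕ.n≤1+n _
  ... | no  _ = ℕ.≤-refl

  length≤cover : {P : Pred A p₁} {Q : Pred A p₂} {R : Pred A p₃}
    (P? : Decidable P) (Q? : Decidable Q) (R? : Decidable R) → (∀ x → P x ⊎ Q x ⊎ R x) → ∀ xs →
    length xs ≤ length (filter P? xs) ℕ.+ (length (filter Q? xs) ℕ.+ length (filter R? xs))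
  length≤cover P? Q? R? cover [] = z≤n
  length≤cover P? Q? R? cover (x ∷ xs) with cover x | length≤cover P? Q? R? cover xs
  ... | inj₁ Px | ih rewrite filter-accept P? {x} {xs} Px = s≤s (ℕ.≤-trans ih
    (ℕ.+-monoʳ-≤ (length (filter P? xs)) (ℕ.+-mono-≤ (length-filter-∷ Q? x xs) (length-filter-∷ R? x xs))))
  ... | inj₂ (inj₁ Qx) | ih rewrite filter-accept Q? {x} {xs} Qx = ℕ.≤-trans (s≤s ih)
    (ℕ.≤-trans (ℕ.≤-reflexive (≡.sym (ℕ.+-suc (length (filter P? xs)) _)))
      (ℕ.+-mono-≤ (length-filter-∷ P? x xs)
        (s≤s (ℕ.+-monoʳ-≤ (length (filter Q? xs)) (length-filter-∷ R? x xs)))))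
  ... | inj₂ (inj₂ Rx) | ih rewrite filter-accept R? {x} {xs} Rx = ℕ.≤-trans (s≤s ih)
    (ℕ.≤-trans (ℕ.≤-reflexive (≡.trans (≡.sym (ℕ.+-suc (length (filter P? xs)) _))
                                (≡.cong (length (filter P? xs) ℕ.+_) (≡.sym (ℕ.+-suc (length (filter Q? xs)) _)))))
      (ℕ.+-mono-≤ (length-filter-∷ P? x xs) (ℕ.+-monoˡ-≤ _ (length-filter-∷ Q? x xs))))

  ∈⇒1≤length : ∀ {x : A} {xs} → x ∈ xs → 1 ≤ length xs
  ∈⇒1≤length (here _)  = z<s
  ∈⇒1≤length (there _) = z<s

  ∈∧∈⇒2≤length : ∀ {x y : A} {xs} → x ≢ y → x ∈ xs → y ∈ xs → 2 ≤ length xs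
  ∈∧∈⇒2≤length x≢y (here x≡)  (here y≡)  = contradiction (≡.trans x≡ (≡.sym y≡)) x≢y
  ∈∧∈⇒2≤length x≢y (here _)   (there y∈) = s≤s (∈⇒1≤length y∈)
  ∈∧∈⇒2≤length x≢y (there x∈) _          = s≤s (∈⇒1≤length x∈)

module SubsetCounting {c ℓ q} {F : FiniteField c ℓ q} where
  open FiniteField F hiding (zero)
  open FieldSequences F using (Distinct)
  open Subset
  open Counting

  elements-distinct : Distinct elements
  elements-distinct = AllPairs.tabulate⁺ λ i≢j fi≈fj →
    i≢j (≡.trans (≡.sym (inverseˡ refl)) (≡.trans (to-cong fi≈fj) (inverseˡ refl)))

  module _ {s} (P : Subset F s) where

    listing : List Carrier
    listing = filter (mem? P) elements

    listing-distinct : Distinct listing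
    listing-distinct = AllPairs.filter⁺ (mem? P) elements-distinct

    listing-mem : All (mem P) listing
    listing-mem = All.all-filter (mem? P) elements

    ∈-listing : ∀ {x} → mem P x → from (to x) ∈ listing
    ∈-listing m = ∈-filter⁺ (mem? P) (∈-tabulate⁺ (to _)) (resp P (sym (from-to _)) m)

    mem⇒1≤∣∣ : ∀ {x} → mem P x → 1 ≤ ∣ P ∣
    mem⇒1≤∣∣ m = ∈⇒1≤length (∈-listing m)

    mem⇒2≤∣∣ : ∀ {x y} → ¬ x ≈ y → mem P x → mem P y → 2 ≤ ∣ P ∣
    mem⇒2≤∣∣ x≉y mx my = ∈∧∈⇒2≤length
      (λ eq → x≉y (trans (sym (from-to _)) (trans (reflexive eq) (from-to _))))
      (∈-listing mx) (∈-listing my)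

    1≤∣∣⇒mem : 1 ≤ ∣ P ∣ → ∃ (mem P)
    1≤∣∣⇒mem = go listing-mem
      where
      go : ∀ {xs} → All (mem P) xs → 1 ≤ length xs → ∃ (mem P)
      go (m ∷ _) _ = _ , m

    2≤∣∣⇒mem : 2 ≤ ∣ P ∣ → ∃ λ x → ∃ λ y → ¬ x ≈ y × mem P x × mem P y
    2≤∣∣⇒mem = go listing-mem listing-distinct
      where
      go : ∀ {xs} → All (mem P) xs → Distinct xs → 2 ≤ length xs →
           ∃ λ x → ∃ λ y → ¬ x ≈ y × mem P x × mem P y
      go (mx ∷ my ∷ _) ((x≉y ∷ _) ∷ _) _ = _ , _ , x≉y , mx , my
      go (_ ∷ []) _ (s≤s ())

  length-zeros≤1 : ∀ {xs} → All (_≈ 0#) xs → Distinct xs → length xs ≤ 1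
  length-zeros≤1 [] _ = z≤n
  length-zeros≤1 (_ ∷ []) _ = ℕ.≤-refl
  length-zeros≤1 (x≈0 ∷ y≈0 ∷ _) ((x≉y ∷ _) ∷ _) = contradiction (trans x≈0 (sym y≈0)) x≉y

-- The quotient set and its complement in the nonzero elements.

module QuotientSets {c ℓ s q} {F : FiniteField c ℓ q} (S : Subset F s) (S⊆F* : S ⊆ˢ F*) where
  open FiniteField F hiding (zero)
  open FieldSequences F using (xy≉0; distinct⇒length≤q; *-cancelˡ-nonzero)
  open Subset
  open Counting using (length≤cover)
  open SubsetCounting {F = F}

  ⁻¹≉0 : ∀ {b} → ¬ b ≈ 0# → ¬ b ⁻¹ ≈ 0#
  ⁻¹≉0 {b} b≉0 b⁻¹≈0 = 0≉1 (trans (sym (zeroʳ b)) (trans (*-congˡ (sym b⁻¹≈0)) (⁻¹-inverse b b≉0)))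

  quotients⊆F* : quotients S ⊆ˢ F*
  quotients⊆F* (a , b , Sa , Sb , x≈) x≈0 =
    xy≉0 (S⊆F* Sa) (⁻¹≉0 (S⊆F* Sb)) (trans (sym x≈) x≈0)

  mem⇒1≤∣quotients∣ : ∀ {a} → mem S a → 1 ≤ ∣ quotients S ∣
  mem⇒1≤∣quotients∣ {a} Sa = mem⇒1≤∣∣ (quotients S) {a / a} (a , a , Sa , Sa , refl)

  mem⇒2≤∣quotients∣ : ∀ {a b} → ¬ a ≈ b → mem S a → mem S b → 2 ≤ ∣ quotients S ∣
  mem⇒2≤∣quotients∣ {a} {b} a≉b Sa Sb = mem⇒2≤∣∣ (quotients S) {a / a} {b / a}
    (λ a/a≈b/a → a≉b (*-cancelˡ-nonzero (⁻¹≉0 (S⊆F* Sa)) (trans (*-comm _ _) (trans a/a≈b/a (*-comm _ _)))))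
    (a , a , Sa , Sa , refl) (b , a , Sb , Sa , refl)

  nonquotients : Subset F _
  nonquotients = record
    { mem  = λ y → ¬ y ≈ 0# × ¬ mem (quotients S) y
    ; mem? = λ y → ¬? (y ≈? 0#) ×-dec ¬? (mem? (quotients S) y)
    ; resp = λ x≈y (x≉0 , x∉) → (λ y≈0 → x≉0 (trans x≈y y≈0)) , λ y∈ → x∉ (resp (quotients S) (sym x≈y) y∈)
    }

  Y : List Carrier
  Y = listing nonquotients

  1≤∣nonquotients∣ : ¬ (quotients S ≐ˢ F*) → 1 ≤ ∣ nonquotients ∣
  1≤∣nonquotients∣ ≢F* with ∃? nonquotients
  ... | yes (_ , y∈) = mem⇒1≤∣∣ nonquotients y∈
  ... | no none = contradiction
    ((λ {x} → quotients⊆F* {x}) , λ {x} x≉0 →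
      decidable-stable (mem? (quotients S) x) λ x∉ → none (x , x≉0 , x∉)) ≢F*

  ∣nonquotients∣<q : 1 < q → ∣ nonquotients ∣ < q
  ∣nonquotients∣<q 1<q = distinct⇒length≤q 1<q {0# ∷ Y}
    (All.map (λ (y≉0 , _) 0≈y → y≉0 (sym 0≈y)) (listing-mem nonquotients) ∷ listing-distinct nonquotients)

  q≤∣nonquotients∣+∣quotients∣+1 : q ≤ ∣ nonquotients ∣ ℕ.+ (∣ quotients S ∣ ℕ.+ 1)
  q≤∣nonquotients∣+∣quotients∣+1 = ℕ.≤-trans (ℕ.≤-reflexive (≡.sym (length-tabulate from)))
    (ℕ.≤-trans (length≤cover (mem? nonquotients) (mem? (quotients S)) (_≈? 0#) cover elements)
      (ℕ.+-monoʳ-≤ ∣ nonquotients ∣ (ℕ.+-monoʳ-≤ ∣ quotients S ∣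
        (length-zeros≤1 (All.all-filter (_≈? 0#) elements)
          (AllPairs.filter⁺ (_≈? 0#) elements-distinct)))))
    where
    cover : ∀ y → mem nonquotients y ⊎ mem (quotients S) y ⊎ y ≈ 0#
    cover y with y ≈? 0# | mem? (quotients S) y
    ... | yes y≈0 | _      = inj₂ (inj₂ y≈0)
    ... | no _    | yes y∈ = inj₂ (inj₁ y∈)
    ... | no y≉0  | no y∉  = inj₁ (y≉0 , y∉)

-- From cliques to distinct values.

module Cliques {c ℓ s q} {F : FiniteField c ℓ q} (S : Subset F s) (S⊆F* : S ⊆ˢ F*)
  {N} (f : Fin N → FiniteField.Carrier F)
  (clique : ∀ {i j} → i ≢ j → Subset.mem S (FiniteField._-_ F (f i) (f j))) where
  open FiniteField F hiding (zero)
  open FieldSequences F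
  open Directions F
  open QuotientSets S S⊆F*
  open SubsetCounting {F = F}
  open Subset
  open import Algebra.Properties.Ring ring using (-‿distribʳ-*; -‿injective; +-cancelˡ; +-cancelʳ)
  open import Relation.Binary.Reasoning.Setoid setoid

  f-injective : ∀ {i j} → f i ≈ f j → i ≡ j
  f-injective {i} {j} fi≈fj with i Fin.≟ j
  ... | yes i≡j = i≡j
  ... | no  i≢j = contradiction (trans (+-congʳ fi≈fj) (-‿inverseʳ (f j))) (S⊆F* (clique i≢j))

  swap-sides : ∀ {u v u′ v′} → u - v ≈ u′ - v′ → u - u′ ≈ v - v′
  swap-sides {u} {v} {u′} {v′} eq = begin
    u - u′                  ≈⟨ +-congʳ (trans (+-congˡ (-‿inverseˡ v)) (+-identityʳ u)) ⟨
    u + (- v + v) - u′      ≈⟨ +-congʳ (+-assoc _ _ _) ⟨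
    u - v + v - u′          ≈⟨ +-congʳ (+-congʳ eq) ⟩
    u′ - v′ + v - u′        ≈⟨ +-congʳ (trans (+-assoc _ _ _) (+-congˡ (+-comm _ _))) ⟩
    u′ + (v - v′) - u′      ≈⟨ +-congʳ (+-comm _ _) ⟩
    v - v′ + u′ - u′        ≈⟨ +-assoc _ _ _ ⟩
    v - v′ + (u′ - u′)      ≈⟨ +-congˡ (-‿inverseʳ u′) ⟩
    v - v′ + 0#             ≈⟨ +-identityʳ _ ⟩
    v - v′                  ∎

  -- A collision says f i - f i′ = y (f j - f j′). If j ≠ j′, then i ≠ i′ because y ≠ 0, and y is a
  -- quotient of two elements of S.
  nonquotient⇒injective : ∀ {y} → mem nonquotients y → InjectiveAt f y
  nonquotient⇒injective {y} (y≉0 , y∉) i j i′ j′ eq with j Fin.≟ j′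
  ... | yes ≡.refl = ≡.refl , f-injective (+-cancelʳ (- (y * f j)) (f i) (f i′) eq)
  ... | no j≢j′ = contradiction y∈ y∉
    where
    D : Carrier
    D = f j - f j′
    D≉0 : ¬ D ≈ 0#
    D≉0 = S⊆F* (clique j≢j′)
    difference : f i - f i′ ≈ y * D
    difference = trans (swap-sides eq) (trans (+-congˡ (-‿distribʳ-* y (f j′))) (sym (distribˡ y _ _)))
    i≢i′ : i ≢ i′
    i≢i′ ≡.refl = xy≉0 y≉0 D≉0 (trans (sym difference) (-‿inverseʳ (f i)))
    y∈ : mem (quotients S) y
    y∈ = f i - f i′ , D , clique i≢i′ , clique j≢j′ , (begin
      y                       ≈⟨ *-identityʳ y ⟨
      y * 1#                  ≈⟨ *-congˡ (⁻¹-inverse D D≉0) ⟨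
      y * (D * D ⁻¹)          ≈⟨ *-assoc _ _ _ ⟨
      y * D * D ⁻¹            ≈⟨ *-congʳ difference ⟨
      (f i - f i′) / D        ∎)

  module _ {p r} (pr : Prime p) (q≡ : q ≡ p ℕ.^ (2 ℕ.* r ℕ.+ 1)) (≢F* : ¬ (quotients S ≐ˢ F*)) where
    private instance
      p≢0 : NonZero p
      p≢0 = prime⇒nonZero pr

    1<p : 1 < p
    1<p = ℕ.nonTrivial⇒n>1 p {{prime⇒nonTrivial pr}}

    1<q : 1 < q
    1<q = ≡.subst (1 <_) (≡.sym q≡)
      (≡.subst (λ n → 1 < p ℕ.^ n) (ℕ.+-comm 1 (2 ℕ.* r))
        (ℕ.<-≤-trans 1<p (ℕ.m≤m*n p (p ℕ.^ (2 ℕ.* r)) {{ℕ.m^n≢0 p (2 ℕ.* r)}})))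

    Y-injective : All (InjectiveAt f) Y
    Y-injective = All.map nonquotient⇒injective (listing-mem nonquotients)

    -- Used for q = 8, where `clique-bound` does not give a strict inequality.
    clique²≤q : N ℕ.* N ≤ q
    clique²≤q = N*N≤q f {r = r} pr q≡ 1<q f-injective Y (listing-distinct nonquotients)
      (1≤∣nonquotients∣ ≢F*) (∣nonquotients∣<q 1<q) Y-injective

    clique-bound : N ≤ p ℕ.^ r ⊎
      ∃ λ k → ∃ λ w → k ≤ p ℕ.^ r × N ≡ k ℕ.+ w × N ℕ.* w ℕ.+ k ≤ ∣ quotients S ∣ ℕ.+ 1
    clique-bound with direction-bound f {r = r} pr q≡ 1<q f-injective Y (listing-distinct nonquotients)
      (1≤∣nonquotients∣ ≢F*) (∣nonquotients∣<q 1<q) Y-injective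
    ... | inj₁ N≤t = inj₁ N≤t
    -- The `+ 1` accounts for 0, which is neither in Y nor in S/S.
    ... | inj₂ (k , w , k≤t , N≡ , le) = inj₂ (k , w , k≤t , N≡ ,
      ℕ.+-cancelˡ-≤ ∣ nonquotients ∣ _ _ (ℕ.≤-trans
        (≡.subst (_≤ q) (ℕ.+-assoc ∣ nonquotients ∣ (N ℕ.* w) k) le) q≤∣nonquotients∣+∣quotients∣+1))

  fromℕ<-≢ : ∀ {i j} (i<N : i < N) (j<N : j < N) → i ≢ j → Fin.fromℕ< i<N ≢ Fin.fromℕ< j<N
  fromℕ<-≢ i<N j<N i≢j eq = i≢j (Fin.fromℕ<-injective _ _ i<N j<N eq)

  2≤N⇒1≤∣quotients∣ : 2 ≤ N → 1 ≤ ∣ quotients S ∣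
  2≤N⇒1≤∣quotients∣ 2≤N = mem⇒1≤∣quotients∣ (clique (fromℕ<-≢ (ℕ.<⇒≤ 2≤N) 2≤N λ ()))

  -- Two edges at a common vertex have distinct differences in S; dividing both by the first gives
  -- two quotients.
  3≤N⇒2≤∣quotients∣ : 3 ≤ N → 2 ≤ ∣ quotients S ∣
  3≤N⇒2≤∣quotients∣ 3≤N = mem⇒2≤∣quotients∣
    (λ eq → fromℕ<-≢ 1<N 3≤N (λ ()) (f-injective (-‿injective (+-cancelˡ (f (Fin.fromℕ< 0<N)) _ _ eq))))
    (clique (fromℕ<-≢ 0<N 1<N λ ())) (clique (fromℕ<-≢ 0<N 3≤N λ ()))
    where
    1<N : 1 < N
    1<N = ℕ.<⇒≤ 3≤N
    0<N : 0 < N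
    0<N = ℕ.<⇒≤ 1<N

-- From the integer bound to the square roots.

module Inequalities where
  open import Data.Integer using (+_; 1ℤ)
  open import Data.Nat using (_+_; _*_)

  <√-intro : ∀ {w m} k x → w ≡ k + x → x * x < m → w <√ m + (+ k)
  <√-intro {m = m} k x ≡.refl x²<m = inj₂ (≡.subst (λ z → z ℤ.* z ℤ.< + m) (≡.sym x≡)
    (≡.subst (ℤ._< + m) (ℤ.pos-* x x) (ℤ.+<+ x²<m)))
    where
    x≡ : + (k + x) ℤ.- + k ≡ + x
    x≡ = ≡.trans (ℤ.[+m]-[+n]≡m⊖n (k + x) k)
      (≡.trans (ℤ.⊖-≥ (ℕ.m≤m+n k x)) (≡.cong +_ (ℕ.m+n∸m≡n k x)))

  <√-negative : ∀ {w m} k → w < k → w <√ m + (+ k)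
  <√-negative {w} k w<k = inj₁ (≡.subst (ℤ._< + 0) (≡.sym (ℤ.[+m]-[+n]≡m⊖n w k))
    (≡.subst (w ℤ.⊖ k ℤ.<_) (ℤ.n⊖n≡0 k) (ℤ.⊖-monoˡ-< k w<k)))

  -- N w + k = N² - (N - 1) k does not increase with k, so the unknown k may be replaced by its
  -- upper bound T.
  k+w⇒bound : ∀ {N T s k w} → 1 ≤ N → k ≤ T → N ≡ k + w → N * w + k ≤ s + 1 →
              N * N + T ≤ s + 1 + N * T
  k+w⇒bound {N} {T} {s} {k} {w} 1≤N k≤T N≡ le = begin
    N * N + T                    ≡⟨ ≡.cong₂ (λ n t → N * n + t) N≡ (≡.sym (ℕ.m+[n∸m]≡n k≤T)) ⟩
    N * (k + w) + (k + d)        ≡⟨ lhs N k w d ⟩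
    N * w + k + (N * k + d)      ≤⟨ ℕ.+-mono-≤ le (ℕ.+-monoʳ-≤ (N * k) (ℕ.m≤n*m d N {{ℕ.>-nonZero 1≤N}})) ⟩
    s + 1 + (N * k + N * d)      ≡⟨ ≡.cong (λ x → s + 1 + x) (ℕ.*-distribˡ-+ N k d) ⟨
    s + 1 + N * (k + d)          ≡⟨ ≡.cong (λ t → s + 1 + N * t) (ℕ.m+[n∸m]≡n k≤T) ⟩
    s + 1 + N * T                ∎
    where
    open ℕ.≤-Reasoning
    d : ℕ
    d = T ∸ k
    lhs : ∀ N k w d → N * (k + w) + (k + d) ≡ N * w + k + (N * k + d)
    lhs = solve-∀

  square-injective : ∀ {m n} → m * m ≡ n * n → m ≡ n
  square-injective {m} {n} eq with ℕ.<-cmp m n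
  ... | tri< m<n _ _ = contradiction eq (ℕ.<⇒≢ (ℕ.*-mono-< m<n m<n))
  ... | tri≈ _ m≡n _ = m≡n
  ... | tri> _ _ n<m = contradiction (≡.sym eq) (ℕ.<⇒≢ (ℕ.*-mono-< n<m n<m))

  -- For N = 2 + m the hypothesis is N (N - 1) ≤ s, and N (N - 1) = (N - 1)² + 1 + m.
  bound⇒square<-prime : ∀ {m s} → (2 + m) * (2 + m) + 1 ≤ s + 1 + (2 + m) * 1 → (1 + m) * (1 + m) < s
  bound⇒square<-prime {m} {s} le = ℕ.+-cancelˡ-≤ (3 + m) _ _ (begin
    3 + m + suc ((1 + m) * (1 + m))  ≤⟨ ℕ.m≤m+n _ m ⟩
    3 + m + suc ((1 + m) * (1 + m)) + m ≡⟨ lhs m ⟩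
    (2 + m) * (2 + m) + 1            ≤⟨ le ⟩
    s + 1 + (2 + m) * 1              ≡⟨ rhs s m ⟩
    3 + m + s                        ∎)
    where
    open ℕ.≤-Reasoning
    lhs : ∀ m → 3 + m + suc ((1 + m) * (1 + m)) + m ≡ (2 + m) * (2 + m) + 1
    lhs = solve-∀
    rhs : ∀ s m → s + 1 + (2 + m) * 1 ≡ 3 + m + s
    rhs = solve-∀

  -- With T = 3 + u, N = T + v and x = 1 + v the hypothesis is x² + (T - 2) x ≤ s. The slack
  -- `v + u * v + u` is (T - 2) x - 1.
  bound⇒square<-power : ∀ {u v s} → (3 + u + v) * (3 + u + v) + (3 + u) ≤ s + 1 + (3 + u + v) * (3 + u) →
                   (1 + v) * (1 + v) < s
  bound⇒square<-power {u} {v} {s} le = ℕ.+-cancelˡ-≤ (1 + (3 + u + v) * (3 + u)) _ _ (begin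
    1 + (3 + u + v) * (3 + u) + suc ((1 + v) * (1 + v)) ≤⟨ ℕ.m≤m+n _ (v + u * v + u) ⟩
    1 + (3 + u + v) * (3 + u) + suc ((1 + v) * (1 + v)) + (v + u * v + u) ≡⟨ lhs u v ⟩
    (3 + u + v) * (3 + u + v) + (3 + u)  ≤⟨ le ⟩
    s + 1 + (3 + u + v) * (3 + u)        ≡⟨ rhs s ((3 + u + v) * (3 + u)) ⟩
    1 + (3 + u + v) * (3 + u) + s        ∎)
    where
    open ℕ.≤-Reasoning
    lhs : ∀ u v → 1 + (3 + u + v) * (3 + u) + suc ((1 + v) * (1 + v)) + (v + u * v + u) ≡
                  (3 + u + v) * (3 + u + v) + (3 + u)
    lhs = solve-∀
    rhs : ∀ s x → s + 1 + x ≡ 1 + x + s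
    rhs = solve-∀

  prime-case : ∀ {N s} → (N ≡ 1 → 1 ≤ s) → N ≤ 1 ⊎ (1 ≤ N → N * N + 1 ≤ s + 1 + N * 1) →
               N <√ s + 1ℤ
  prime-case {zero}        _   _              = <√-negative 1 z<s
  prime-case {suc zero}    1≤s _              = <√-intro 1 0 ≡.refl (1≤s ≡.refl)
  prime-case {suc (suc m)} _   (inj₁ (s≤s ()))
  prime-case {suc (suc m)} _   (inj₂ bound)   = <√-intro 1 (suc m) ≡.refl (bound⇒square<-prime {m} (bound z<s))

  -- Let x = N - T + 1. A negative x is immediate, x = 0 and x = 1 need only s ≥ 1 and s ≥ 2, and x
  -- ≥ 2 follows from the bound when T ≥ 3. For T = 2 the bound gives just x² ≤ s, hence the
  -- separate hypothesis, which makes x at most 1.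
  prime-power-case : ∀ {N T s} → 2 ≤ T → (T ≡ 2 → N ≤ 2 × 2 ≤ s) → (2 ≤ N → 1 ≤ s) → (3 ≤ N → 2 ≤ s) →
                     N ≤ T ⊎ (1 ≤ N → N * N + T ≤ s + 1 + N * T) → N <√ s + (+ T ℤ.- 1ℤ)
  prime-power-case {N} {suc (suc t)} {s} (s≤s (s≤s z≤n)) T≡2⇒ 2≤N⇒ 3≤N⇒ alternatives
    with ℕ.<-cmp N (suc t)
  ... | tri< N<1+t _ _ = <√-negative (suc t) N<1+t
  ... | tri≈ _ ≡.refl _ = <√-intro (suc t) 0 (≡.sym (ℕ.+-identityʳ (suc t))) (1≤s t T≡2⇒ 2≤N⇒)
    where
    1≤s : ∀ t → (suc (suc t) ≡ 2 → suc t ≤ 2 × 2 ≤ s) → (2 ≤ suc t → 1 ≤ s) → 1 ≤ s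
    1≤s zero    h _ = ℕ.<⇒≤ (proj₂ (h ≡.refl))
    1≤s (suc t) _ h = h (s<s z<s)
  ... | tri> _ _ 1+t<N with ℕ.m≤n⇒∃[o]m+o≡n 1+t<N
  ...   | zero , ≡.refl = <√-intro (suc t) 1 (≡.trans (ℕ.+-identityʳ _) (ℕ.+-comm 1 (suc t))) (2≤s t T≡2⇒ 3≤N⇒)
    where
    2≤s : ∀ t → (suc (suc t) ≡ 2 → suc (suc t) + 0 ≤ 2 × 2 ≤ s) → (3 ≤ suc (suc t) + 0 → 2 ≤ s) → 2 ≤ s
    2≤s zero    h _ = proj₂ (h ≡.refl)
    2≤s (suc t) _ h = h (s<s (s<s z<s))
  ...   | suc v , ≡.refl = <√-intro (suc t) (2 + v) (rearrange t v) (square< t T≡2⇒ alternatives)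
    where
    rearrange : ∀ t v → suc (suc t) + suc v ≡ suc t + (2 + v)
    rearrange = solve-∀
    square< : ∀ t → (suc (suc t) ≡ 2 → suc (suc t) + suc v ≤ 2 × 2 ≤ s) →
      let N = suc (suc t) + suc v; T = suc (suc t) in
      N ≤ T ⊎ (1 ≤ N → N * N + T ≤ s + 1 + N * T) → (2 + v) * (2 + v) < s
    square< zero    h _ = contradiction (proj₁ (h ≡.refl)) (ℕ.<⇒≱ (s<s (s<s z<s)))
    square< (suc t) _ (inj₁ N≤T) = contradiction N≤T (ℕ.<⇒≱ (ℕ.m<m+n (3 + t) z<s))
    square< (suc t) _ (inj₂ bound) = bound⇒square<-power {t} {suc v} (bound z<s)

open import Data.Nat using (ℕ; _+_; _*_; _^_; _≤_)
open import Data.Integer using (+_; 1ℤ; _-_)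

-- The two exclusions are cases in which the inequality is an equality: 1 = 0 + 1 for q = p and S
-- empty; for q = 8, 1 = 0 + 2 - 1 with S empty and 2 = 1 + 2 - 1 with S a single element. The
-- number t is √(q/p).
theorem1p2 : ∀ {c ℓ s} (p q r : ℕ) → Prime p → q ≡ p ^ (2 * r + 1) →
    (F : FiniteField c ℓ q) (S : Subset F s)
    (S⊆F* : S ⊆ˢ F*) (S≐-S : S ≐ˢ neg S) →
    ¬ (quotients S ≐ˢ F*) →
    ¬ (q ≡ p × ∣ S ∣ ≡ 0) →
    ¬ (q ≡ 8 × ∣ S ∣ ≤ 1) →
    (ω : ℕ) → IsCliqueNumber (Cay S S⊆F* S≐-S) ω →
    (q ≡ p → ω <√ ∣ quotients S ∣ + 1ℤ) ×
    (q ≢ p → (t : ℕ) → t * t * p ≡ q → ω <√ ∣ quotients S ∣ + (+ t - 1ℤ))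
theorem1p2 p q r pr q≡ F S S⊆F* S≐-S ≢F* S≢∅ 8⇒2≤∣S∣ ω ((f , clique) , _) = q≡p-case , q≢p-case
  where
  open SubsetCounting {F = F}
  open QuotientSets S S⊆F*
  open Cliques S S⊆F* f clique
  open Inequalities

  instance
    p≢0 : NonZero p
    p≢0 = prime⇒nonZero pr

  2≤p : 2 ≤ p
  2≤p = 1<p {r = r} pr q≡ ≢F*

  alternatives : ω ≤ p ^ r ⊎ (1 ≤ ω → ω * ω + p ^ r ≤ ∣ quotients S ∣ + 1 + ω * p ^ r)
  alternatives with clique-bound {r = r} pr q≡ ≢F*
  ... | inj₁ ω≤t                     = inj₁ ω≤t
  ... | inj₂ (k , w , k≤t , ω≡ , le) = inj₂ λ 1≤ω → k+w⇒bound 1≤ω k≤t ω≡ le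

  q≡p-case : q ≡ p → ω <√ ∣ quotients S ∣ + 1ℤ
  q≡p-case q≡p = prime-case (λ _ → 1≤∣quotients∣)
    (≡.subst (λ t → ω ≤ t ⊎ (1 ≤ ω → ω * ω + t ≤ ∣ quotients S ∣ + 1 + ω * t)) p^r≡1 alternatives)
    where
    p^r≡1 : p ^ r ≡ 1
    p^r≡1 = ≡.cong (p ^_) (r≡0 r (≡.trans (≡.sym q≡p) q≡))
      where
      r≡0 : ∀ r → p ≡ p ^ (2 * r + 1) → r ≡ 0
      r≡0 zero    _  = ≡.refl
      r≡0 (suc r) eq = contradiction (≡.trans (ℕ.*-identityʳ p) eq)
        (ℕ.<⇒≢ (ℕ.^-monoʳ-< p 2≤p (s<s (ℕ.<-≤-trans z<s (ℕ.m≤n+m 1 (r + suc (r + 0)))))))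
    1≤∣quotients∣ : 1 ≤ ∣ quotients S ∣
    1≤∣quotients∣ = mem⇒1≤∣quotients∣ (proj₂ (1≤∣∣⇒mem S (ℕ.n≢0⇒n>0 λ ∣S∣≡0 → S≢∅ (q≡p , ∣S∣≡0))))

  q≢p-case : q ≢ p → (t : ℕ) → t * t * p ≡ q → ω <√ ∣ quotients S ∣ + (+ t - 1ℤ)
  q≢p-case q≢p t ttp≡q = prime-power-case (2≤t r q≡ t≡) t≡2⇒ 2≤N⇒1≤∣quotients∣ 3≤N⇒2≤∣quotients∣
    (≡.subst (λ t → ω ≤ t ⊎ (1 ≤ ω → ω * ω + t ≤ ∣ quotients S ∣ + 1 + ω * t)) (≡.sym t≡) alternatives)
    where
    t≡ : t ≡ p ^ r
    t≡ = square-injective (ℕ.*-cancelʳ-≡ _ _ p (≡.trans ttp≡q (≡.trans q≡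
      (≡.trans (ℕ.^-distribˡ-+-* p (2 * r) 1) (≡.cong₂ _*_
        (≡.trans (ℕ.^-distribˡ-+-* p r (r + 0)) (≡.cong (λ n → p ^ r * p ^ n) (ℕ.+-identityʳ r)))
        (ℕ.*-identityʳ p))))))

    2≤t : ∀ r → q ≡ p ^ (2 * r + 1) → t ≡ p ^ r → 2 ≤ t
    2≤t zero    q≡ _  = contradiction (≡.trans q≡ (ℕ.*-identityʳ p)) q≢p
    2≤t (suc r) _  t≡ = ≡.subst (2 ≤_) (≡.sym t≡)
      (ℕ.≤-trans 2≤p (ℕ.m≤m*n p (p ^ r) {{ℕ.m^n≢0 p r}}))

    t≡2⇒q≡8 : t ≡ 2 → q ≡ 8
    t≡2⇒q≡8 ≡.refl = ≡.trans (≡.sym ttp≡q) (≡.cong (4 *_) (ℕ.≤-antisym (∣.∣⇒≤ (p∣2 r q≡ t≡)) 2≤p))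
      where
      p∣2 : ∀ r → q ≡ p ^ (2 * r + 1) → 2 ≡ p ^ r → p ∣.∣ 2
      p∣2 zero    q≡ _  = contradiction (≡.trans q≡ (ℕ.*-identityʳ p)) q≢p
      p∣2 (suc r) _  eq = ≡.subst (p ∣.∣_) (≡.sym eq) (∣.m∣m*n (p ^ r))

    -- Here q = 8: three vertices would give 9 ≤ 8, and the exclusion for q = 8 provides two
    -- distinct elements of S.
    t≡2⇒ : t ≡ 2 → ω ≤ 2 × 2 ≤ ∣ quotients S ∣
    t≡2⇒ t≡2 = ℕ.≮⇒≥ 3≤ω⇒⊥ , 2≤∣quotients∣
      where
      3≤ω⇒⊥ : ¬ 3 ≤ ω
      3≤ω⇒⊥ 3≤ω = ℕ.<⇒≱ (ℕ.n<1+n 8) (ℕ.≤-trans (ℕ.*-mono-≤ 3≤ω 3≤ω)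
        (≡.subst (ω * ω ≤_) (t≡2⇒q≡8 t≡2) (clique²≤q {r = r} pr q≡ ≢F*)))
      2≤∣quotients∣ : 2 ≤ ∣ quotients S ∣
      2≤∣quotients∣ with 2≤∣∣⇒mem S (ℕ.≰⇒> λ ∣S∣≤1 → 8⇒2≤∣S∣ (t≡2⇒q≡8 t≡2 , ∣S∣≤1))
      ... | _ , _ , a≉b , Sa , Sb = mem⇒2≤∣quotients∣ a≉b Sa Sb
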